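{- Let $n\ge 0$ be an integer with $n\not\equiv 4\pmod 7$. For a $4$-core partition $\lambda$ of $7n+2$ with $4$-abacus $(0,a_1,a_2,a_3)$, set $b_j=4a_j+j$ for $j=1,2,3$, order the indices as $\{j_1,j_2,j_3\}=\{1,2,3\}$ with $b_{j_1}<b_{j_2}<b_{j_3}$, and let \[ \mathcal{C}=\Big\{ b_{j_2},\ b_{j_3},\ b_{j_2}-b_{j_1},\ b_{j_3}-b_{j_1},\ \tfrac{b_{j_2}+b_{j_3}-b_{j_1}}{2},\ b_{j_2}+b_{j_3}-b_{j_1}\Big\}. \] Then the six elements of $\mathcal{C}$ are integers, pairwise distinct and nonzero modulo $7$; writing $c_i$ for the unique element of $\mathcal{C}$ congruent to $i\pmod 7$ ($1\le i\le 6$), the tuple \[ \varphi(\lambda)=\Big(0,\big\lfloor \tfrac{c_1}{7}\big\rfloor,\big\lfloor \tfrac{c_2}{7}\big\rfloor,\big\lfloor \tfrac{c_3}{7}\big\rfloor,\big\lfloor \tfrac{c_4}{7}\big\rfloor,\big\lfloor \tfrac{c_5}{7}\big\rfloor,\big\lfloor \tfrac{c_6}{7}\big\rfloor\Big) \] is the $7$-abacus of a self-conjugate $7$-core partition of $8n+1$, and the resulting map $\varphi\colon C_4(7n+2)\to SC_7(8n+1)$ is two-to-one (every element of $SC_7(8n+1)$ has exactly two preimages).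
   Context: For a partition $\lambda=(\lambda_1\ge\dots\ge\lambda_s>0)$ with $s$ parts, the structure numbers are $B_j=\lambda_j-j+s$. For a $t$-core (a partition none of whose hook lengths is divisible by $t$), letting $m_c$ be the number of structure numbers congruent to $c$ modulo $t$, one has $m_0=0$ and the structure numbers congruent to $c$ are exactly $c,c+t,\dots,c+(m_c-1)t$; the tuple $(0,m_1,\dots,m_{t-1})$ is the $t$-abacus of $\lambda$ and determines $\lambda$ uniquely (conversely every such tuple of nonnegative integers is the abacus of a $t$-core). $C_4(m)$ is the set of $4$-cores of $m$ and $SC_7(m)$ the set of self-conjugate $7$-cores of $m$ (self-conjugate meaning equal to its conjugate). -}

module Defs where

open import Data.Nat using (ℕ; zero; suc; _+_; _*_; _∸_; _≤_; _<_; _≥_; _<?_; _≤ᵇ_; _≡ᵇ_; NonZero)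
open import Data.Nat.DivMod using (_%_; _/_)
open import Data.Nat.Divisibility using (_∣_)
open import Data.Nat.Properties using (_≟_)
open import Data.List using (List; []; _∷_; length; map; filter; upTo; concatMap)
open import Data.Nat.ListAction using (sum)
open import Data.List.Relation.Unary.All using (All)
open import Data.List.Relation.Unary.Linked using (Linked)
open import Data.Vec as V using (Vec)
open import Data.Fin using (Fin; toℕ)
open import Data.Bool using (if_then_else_)
open import Data.Product using (_×_; _,_)
open import Relation.Nullary using (¬_)
open import Relation.Binary.PropositionalEquality using (_≡_)

Partition : Set
Partition = List ℕ

IsPartition : Partition → Set
IsPartition λ′ = Linked _≥_ λ′ × All (λ x → 0 < x) λ′

size : Partition → ℕ
size = sum

at : Partition → ℕ → ℕ
at []       _       = 0
at (x ∷ _)  zero    = x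
at (_ ∷ xs) (suc i) = at xs i

conj : Partition → Partition
conj λ′ = map (λ j → length (filter (λ x → j <? x) λ′)) (upTo (at λ′ 0))

SelfConjugate : Partition → Set
SelfConjugate λ′ = conj λ′ ≡ λ′

-- hook lengths of all cells (i , j), 0-indexed, j < λ_i :
-- arm + leg + 1 = (λ_i - j - 1) + (λ'_j - i - 1) + 1
hooks : Partition → List ℕ
hooks λ′ = concatMap (λ i → map (λ j → (at λ′ i ∸ suc j) + (at (conj λ′) j ∸ suc i) + 1)
                                (upTo (at λ′ i)))
                     (upTo (length λ′))

IsCore : ℕ → Partition → Set
IsCore t λ′ = All (λ h → ¬ (t ∣ h)) (hooks λ′)

-- structure numbers B_j = λ_j - j + s (j = 1..s); with 0-indexed i: λ_i + (s - 1 - i)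
structureNumbers : Partition → List ℕ
structureNumbers λ′ = map (λ i → at λ′ i + (length λ′ ∸ suc i)) (upTo (length λ′))

abacus : (t : ℕ) .{{_ : NonZero t}} → Partition → Vec ℕ t
abacus t λ′ = V.tabulate (λ (c : Fin t) →
  length (filter (λ x → (x % t) ≟ toℕ c) (structureNumbers λ′)))

InC : (t m : ℕ) → Partition → Set
InC t m λ′ = IsPartition λ′ × IsCore t λ′ × size λ′ ≡ m

InSC : (t m : ℕ) → Partition → Set
InSC t m λ′ = InC t m λ′ × SelfConjugate λ′

sort3 : ℕ → ℕ → ℕ → ℕ × ℕ × ℕ
sort3 x y z =
  if x ≤ᵇ y
  then (if y ≤ᵇ z then (x , y , z) else (if x ≤ᵇ z then (x , z , y) else (z , x , y)))
  else (if x ≤ᵇ z then (y , x , z) else (if y ≤ᵇ z then (y , z , x) else (z , y , x)))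

sortedB : Partition → ℕ × ℕ × ℕ
sortedB λ′ = sort3 (4 * V.lookup ab (Fin.suc Fin.zero) + 1)
                   (4 * V.lookup ab (Fin.suc (Fin.suc Fin.zero)) + 2)
                   (4 * V.lookup ab (Fin.suc (Fin.suc (Fin.suc Fin.zero))) + 3)
  where
    import Data.Fin as Fin
    ab = abacus 4 λ′

-- b_{j2} + b_{j3} - b_{j1} (nonnegative since b_{j1} is the smallest)
sumB : Partition → ℕ
sumB λ′ with sortedB λ′
... | (b1 , b2 , b3) = b2 + b3 ∸ b1

-- the list C = [ b2 , b3 , b2 - b1 , b3 - b1 , (b2 + b3 - b1)/2 , b2 + b3 - b1 ]
-- (the halving is ℕ-division by 2; the theorem asserts the numerator is even)
calC : Partition → List ℕ
calC λ′ with sortedB λ′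
... | (b1 , b2 , b3) = b2 ∷ b3 ∷ (b2 ∸ b1) ∷ (b3 ∸ b1) ∷ ((b2 + b3 ∸ b1) / 2) ∷ (b2 + b3 ∸ b1) ∷ []

-- first element of a list congruent to i mod 7 (the unique one, under the theorem's conclusion)
pick : ℕ → List ℕ → ℕ
pick i []       = 0
pick i (x ∷ xs) = if (x % 7) ≡ᵇ i then x else pick i xs

φ : Partition → Vec ℕ 7
φ λ′ = 0 V.∷ V.map (λ i → pick i (calC λ′) / 7) (1 V.∷ 2 V.∷ 3 V.∷ 4 V.∷ 5 V.∷ 6 V.∷ V.[])

{-# OPTIONS --safe #-}
-- Let S be the set of structure numbers of a partition.  The hook lengths are the differences
-- x − y with y < x, x ∈ S and y ∉ S, so λ is a t-core iff S is closed under subtracting t, that is,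
-- iff on each residue class r mod t it is the set of numbers of this class below a threshold
-- c_r = t m_r + r.  Conjugation reflects the complement of S, so a t-core is self-conjugate iff the
-- thresholds are symmetric, c ↦ A − c with A the largest one.
--
-- The thresholds of a self-conjugate 7-core are therefore 2h > h+e > h+d > h > h−d > h−e > 0, while
-- a 4-core with sorted thresholds 0 < x < y < z and 2h = y + z − x has z = h + e, and y = h + d or
-- y = h − d; these two signs are the two preimages.  Both size formulas become
--   h² + d² + e² = 8 |λ| + 5 = 7 |μ| + 14.
-- Modulo 7 a nonzero solution of h² + d² + e² ≡ 0 has the six candidates distinct and nonzero (and
-- n ≢ 4 excludes the zero solution); modulo 8 every solution gives x, y, z the residues 1, 2, 3
-- modulo 4 in some order.  Both are finite checks.
module Submission where

open import Defs
open import Data.Bool using (Bool; true; false; T)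
open import Data.Fin as Fin using (toℕ)
open import Data.List using (List; []; _∷_; _++_; length; map; filter; upTo; applyUpTo; downFrom; reverse)
open import Data.List.Membership.Propositional using (_∈_; _∉_; find; lose)
open import Data.List.Membership.Propositional.Properties
  using (∈-map⁺; ∈-map⁻; ∈-upTo⁺; ∈-upTo⁻; ∈-applyUpTo⁻; ∈-downFrom⁺; ∈-concatMap⁺; ∈-concatMap⁻;
         ∈-filter⁺; ∈-filter⁻; ∈-∃++)
open import Data.List.Properties
  using (map-applyUpTo; map-upTo; map-∘; map-id-local; length-map; length-upTo; length-filter;
         filter-accept; filter-reject; filter-none; ∷-injectiveˡ; ∷-injectiveʳ)
open import Data.List.Relation.Binary.Permutation.Propositional
  using (_↭_; ↭-refl; ↭-sym; ↭-trans; ↭-reflexive; ↭⇒↭ₛ; prep; swap)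
open import Data.List.Relation.Binary.Permutation.Propositional.Properties as Perm
  using (∈-resp-↭; All-resp-↭)
import Data.List.Relation.Binary.Permutation.Setoid.Properties as SetoidPerm
open import Data.List.Relation.Unary.All as All using (All; []; _∷_)
import Data.List.Relation.Unary.All.Properties as All
open import Data.List.Relation.Unary.AllPairs as AllPairs using (AllPairs; []; _∷_; allPairs?)
import Data.List.Relation.Unary.AllPairs.Properties as AllPairs
open import Data.List.Relation.Unary.Any as Any using (Any; here; there; any?)
open import Data.List.Relation.Unary.Linked using ([-]; _∷_)
open import Data.List.Relation.Unary.Linked.Properties as Linked using (Linked⇒AllPairs; AllPairs⇒Linked)
open import Data.List.Relation.Unary.Unique.Propositional using (Unique)
open import Data.List.Relation.Unary.Unique.Propositional.Properties using (upTo⁺)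
open import Data.Nat
open import Data.Nat.DivMod
open import Data.Nat.Divisibility using (_∣_; divides; divides-refl; ∣-refl; ∣m+n∣m⇒∣n; m∣m*n)
open import Data.Nat.ListAction using (sum)
open import Data.Nat.ListAction.Properties using (sum-↭)
open import Data.Nat.Properties
open import Data.List.Membership.DecPropositional _≟_ using (_∈?_)
open import Data.Nat.Tactic.RingSolver using (solve-∀)
open import Data.Product using (_×_; _,_; proj₁; proj₂; ∃; ∃₂)
open import Data.Sum using (_⊎_; inj₁; inj₂)
open import Data.Unit using (tt)
import Data.Vec as V
open import Function using (_∘_; id; const)
open import Relation.Binary.Definitions using (tri<; tri≈; tri>)
open import Relation.Binary.PropositionalEquality
open import Relation.Nullary using (¬_; Dec; yes; no; contradiction; _×-dec_; _⊎-dec_; _→-dec_; ¬?)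
open import Relation.Nullary.Decidable using (True; toWitness)

-- The six numbers of `calC` together with 0 turn out to be the seven thresholds of the 7-core, and
-- changing the sign of d only permutes the six. So φ identifies the two signs and nothing else, and
-- is two-to-one once d > 0. The ordering of the positive numbers b gives h - e > 0 and e - d > 0,
-- but not d > 0: the sum of the two smaller ones may equal the largest, as for the empty partition
-- with 1, 2, 3. It is distinctness modulo 7 that excludes d = 0, and this is where n ≢ 4 enters.
-- The half sum h is an integer because the thresholds of a 4-core with l parts add up to 4l + 6.
-- The sizes match because 8(7n + 2) + 5 = 7(8n + 1) + 14 = 56n + 21. Lists of thresholds are kept
-- in order of size and not of residue. Which residue an entry has then never needs to be known,
-- only that the residues are all different.

Decreasing : List ℕ → Set
Decreasing = AllPairs _>_

-- Each head is the maximum of the common set, so the heads agree and can be stripped. This turns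
-- equality of sets into equality of lists, for beta sets and for lists of thresholds.
decreasing-≡ : ∀ {xs ys} → Decreasing xs → Decreasing ys →
  (∀ {x} → x ∈ xs → x ∈ ys) → (∀ {x} → x ∈ ys → x ∈ xs) → xs ≡ ys
decreasing-≡ [] [] _ _ = refl
decreasing-≡ [] (_ ∷ _) _ g with () ← g (here refl)
decreasing-≡ (_ ∷ _) [] f _ with () ← f (here refl)
decreasing-≡ {x ∷ xs} {y ∷ ys} (x> ∷ dx) (y> ∷ dy) f g = cong₂ _∷_ x≡y
  (decreasing-≡ dx dy (λ p → strip (f (there p)) (subst (_ <_) x≡y (All.lookup x> p)))
                      (λ p → strip (g (there p)) (subst (_ <_) (sym x≡y) (All.lookup y> p))))
  where
  bound : ∀ {z w ws} → All (_< w) ws → z ∈ w ∷ ws → z ≤ w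
  bound _  (here refl) = ≤-refl
  bound w> (there p)   = <⇒≤ (All.lookup w> p)
  x≡y : x ≡ y
  x≡y = ≤-antisym (bound y> (f (here refl))) (bound x> (g (here refl)))
  strip : ∀ {z w} {ws : List ℕ} → z ∈ w ∷ ws → z < w → z ∈ ws
  strip (here refl) z<z = contradiction z<z (<-irrefl refl)
  strip (there p)   _   = p

-- Rows and columns of a diagram

column : ℕ → Partition → ℕ
column j λ′ = length (filter (λ x → j <? x) λ′)

WeaklyDecreasing : List ℕ → Set
WeaklyDecreasing = AllPairs _≥_

column-accept : ∀ {j x} xs → j < x → column j (x ∷ xs) ≡ suc (column j xs)
column-accept xs p = cong length (filter-accept (λ x → _ <? x) {xs = xs} p)

column-reject : ∀ {j x} xs → x ≤ j → column j (x ∷ xs) ≡ column j xs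
column-reject xs p = cong length (filter-reject (λ x → _ <? x) {xs = xs} (≤⇒≯ p))

column-none : ∀ {j} xs → All (_≤ j) xs → column j xs ≡ 0
column-none xs p = cong length (filter-none (λ x → _ <? x) (All.map ≤⇒≯ p))

at-bounded : ∀ {j} xs → All (_≤ j) xs → ∀ i → at xs i ≤ j
at-bounded []       _        i       = z≤n
at-bounded (x ∷ xs) (p ∷ _)  zero    = p
at-bounded (x ∷ xs) (_ ∷ ps) (suc i) = at-bounded xs ps i

-- Rows weakly decrease, so the rows longer than j form an initial segment, and `column j` is its
-- length. Together with `column⇒row` this is the adjunction behind conjugation.
row⇒column : ∀ {λ′} → WeaklyDecreasing λ′ → ∀ i {j} → j < at λ′ i → i < column j λ′
row⇒column {x ∷ xs} (x≥ ∷ w) zero p rewrite column-accept xs p = z<s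
row⇒column {x ∷ xs} (x≥ ∷ w) (suc i) p
  rewrite column-accept xs (<-≤-trans p (at-bounded xs x≥ i)) = s<s (row⇒column w i p)

column⇒row : ∀ {λ′} → WeaklyDecreasing λ′ → ∀ i {j} → i < column j λ′ → j < at λ′ i
column⇒row {x ∷ xs} (x≥ ∷ w) i {j} p with <-≤-connex j x
column⇒row {x ∷ xs} (x≥ ∷ w) zero    p | inj₁ q = q
column⇒row {x ∷ xs} (x≥ ∷ w) (suc i) p | inj₁ q =
  column⇒row w i (≤-pred (subst (suc i <_) (column-accept xs q) p))
column⇒row {x ∷ xs} (x≥ ∷ w) i       p | inj₂ q =
  contradiction (subst (i <_) (trans (column-reject xs q)
    (column-none xs (All.map (λ y≤x → ≤-trans y≤x q) x≥))) p) n≮0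

column≤length : ∀ j xs → column j xs ≤ length xs
column≤length j xs = length-filter (λ x → j <? x) xs

row-index : ∀ xs i {j} → j < at xs i → i < length xs
row-index (x ∷ xs) zero    p = z<s
row-index (x ∷ xs) (suc i) p = s<s (row-index xs i p)

at-applyUpTo : ∀ f {n i} → i < n → at (applyUpTo f n) i ≡ f i
at-applyUpTo f {suc n} {zero}  p = refl
at-applyUpTo f {suc n} {suc i} p = at-applyUpTo (f ∘ suc) (≤-pred p)

conj-applyUpTo : ∀ λ′ → conj λ′ ≡ applyUpTo (λ j → column j λ′) (at λ′ 0)
conj-applyUpTo λ′ = map-upTo (λ j → column j λ′) (at λ′ 0)

at-conj : ∀ λ′ {j} → j < at λ′ 0 → at (conj λ′) j ≡ column j λ′
at-conj λ′ p = trans (cong (λ μ → at μ _) (conj-applyUpTo λ′)) (at-applyUpTo _ p)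

length-conj : ∀ λ′ → length (conj λ′) ≡ at λ′ 0
length-conj λ′ = trans (length-map (λ j → column j λ′) (upTo (at λ′ 0))) (length-upTo (at λ′ 0))

weaklyDecreasing : ∀ {λ′} → IsPartition λ′ → WeaklyDecreasing λ′
weaklyDecreasing (l , _) = Linked⇒AllPairs (λ p q → ≤-trans q p) l

row≤head : ∀ {λ′} → WeaklyDecreasing λ′ → ∀ i → at λ′ i ≤ at λ′ 0
row≤head {[]}     _        i       = z≤n
row≤head {x ∷ xs} _        zero    = ≤-refl
row≤head {x ∷ xs} (x≥ ∷ _) (suc i) = at-bounded xs x≥ i

conj-partition : ∀ {λ′} → IsPartition λ′ → IsPartition (conj λ′)
conj-partition {λ′} part = subst IsPartition (sym (conj-applyUpTo λ′))
  ( Linked.applyUpTo⁺₁ _ _ (λ {i} _ → column-antitone i)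
  , All.tabulate positive )
  where
  w = weaklyDecreasing part
  column-antitone : ∀ j → column (suc j) λ′ ≤ column j λ′
  -- Otherwise the row with index `column j` is longer than j + 1, hence longer than j, and would be
  -- counted by `column j`.
  column-antitone j = ≮⇒≥ λ p →
    <-irrefl refl (row⇒column w (column j λ′) (<-trans (n<1+n j) (column⇒row w _ p)))
  positive : ∀ {x} → x ∈ applyUpTo (λ j → column j λ′) (at λ′ 0) → 0 < x
  positive p with j , j< , refl ← ∈-applyUpTo⁻ _ p = row⇒column w 0 j<

-- Beta sets

-- The structure numbers by recursion: each depends only on its part and on how many parts follow,
-- so the tail keeps its own values.
beta : Partition → List ℕ
beta []       = []
beta (x ∷ xs) = (x + length xs) ∷ beta xs

structureNumbers≡beta : ∀ λ′ → structureNumbers λ′ ≡ beta λ′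
structureNumbers≡beta []       = refl
structureNumbers≡beta (x ∷ xs) = cong ((x + length xs) ∷_)
  (trans (map-applyUpTo suc (λ i → at (x ∷ xs) i + (suc (length xs) ∸ suc i)) (length xs))
  (trans (sym (map-upTo (λ i → at xs i + (length xs ∸ suc i)) (length xs)))
         (structureNumbers≡beta xs)))

length-beta : ∀ λ′ → length (beta λ′) ≡ length λ′
length-beta []       = refl
length-beta (x ∷ xs) = cong suc (length-beta xs)

beta-bounded : ∀ {x} xs → All (_≤ x) xs → All (_< x + length xs) (beta xs)
beta-bounded []       [] = []
beta-bounded {x} (y ∷ ys) (p ∷ ps) =
  subst (y + length ys <_) (sym (+-suc x (length ys))) (s≤s (+-monoˡ-≤ (length ys) p))
  ∷ All.map (λ q → <-trans q (+-monoʳ-< x (n<1+n (length ys)))) (beta-bounded ys ps)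

beta-decreasing : ∀ {λ′} → WeaklyDecreasing λ′ → Decreasing (beta λ′)
beta-decreasing []       = []
beta-decreasing {x ∷ xs} (p ∷ ps) = beta-bounded xs p ∷ beta-decreasing ps

beta-positive : ∀ {λ′} → All (0 <_) λ′ → All (0 <_) (beta λ′)
beta-positive []       = []
beta-positive (p ∷ ps) = <-≤-trans p (m≤m+n _ _) ∷ beta-positive ps

beta-injective : ∀ {xs ys} → beta xs ≡ beta ys → xs ≡ ys
beta-injective {[]}     {[]}     _ = refl
beta-injective {x ∷ xs} {y ∷ ys} e
  with refl ← beta-injective {xs} {ys} (∷-injectiveʳ e)
  = cong (_∷ xs) (+-cancelʳ-≡ (length xs) x y (∷-injectiveˡ e))

-- Index and position are tied by an equation free of truncated subtraction. Gaps satisfy the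
-- analogous equation with `column j`, and hook lengths arise as differences of the two.
∈-beta⁻ : ∀ {λ′ x} → x ∈ beta λ′ → ∃ λ i → i < length λ′ × x + suc i ≡ at λ′ i + length λ′
∈-beta⁻ {x ∷ xs} (here refl) = 0 , z<s , eq x (length xs)
  where
  eq : ∀ a b → a + b + 1 ≡ a + suc b
  eq = solve-∀
∈-beta⁻ {y ∷ xs} {x} (there p) with i , i< , e ← ∈-beta⁻ {xs} p =
  suc i , s<s i< , trans (+-suc x (suc i)) (trans (cong suc e) (sym (+-suc _ _)))

∈-beta⁺ : ∀ {λ′ x} i → i < length λ′ → x + suc i ≡ at λ′ i + length λ′ → x ∈ beta λ′
∈-beta⁺ {y ∷ xs} {x} zero _ e = here (+-cancelʳ-≡ 1 x (y + length xs) (trans e (eq y (length xs))))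
  where
  eq : ∀ a b → a + suc b ≡ a + b + 1
  eq = solve-∀
∈-beta⁺ {y ∷ xs} {x} (suc i) p e = there (∈-beta⁺ i (≤-pred p)
  (suc-injective (trans (sym (+-suc x (suc i))) (trans e (+-suc _ _)))))

-- Each column j contributes one vacant position y = length + j − column j, and all arise in this way.

gap-∉ : ∀ {λ′} → WeaklyDecreasing λ′ → ∀ {y} j → y + column j λ′ ≡ length λ′ + j → y ∉ beta λ′
gap-∉ {λ′} w {y} j e p with i , _ , e′ ← ∈-beta⁻ {λ′} p | j <? at λ′ i
... | yes q = <-irrefl refl (begin-strict
  y + suc i           ≤⟨ +-monoʳ-≤ y (row⇒column w i q) ⟩
  y + column j λ′     ≡⟨ e ⟩
  length λ′ + j       <⟨ +-monoʳ-< (length λ′) q ⟩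
  length λ′ + at λ′ i ≡⟨ +-comm (length λ′) _ ⟩
  at λ′ i + length λ′ ≡⟨ e′ ⟨
  y + suc i           ∎)
  where open ≤-Reasoning
... | no q = <-irrefl refl (begin-strict
  y + suc i           ≡⟨ e′ ⟩
  at λ′ i + length λ′ ≤⟨ +-monoˡ-≤ (length λ′) (≮⇒≥ q) ⟩
  j + length λ′       ≡⟨ +-comm j _ ⟩
  length λ′ + j       ≡⟨ e ⟨
  y + column j λ′     ≤⟨ +-monoʳ-≤ y (≮⇒≥ (q ∘ column⇒row w i)) ⟩
  y + i               <⟨ +-monoʳ-< y (n<1+n i) ⟩
  y + suc i           ∎)
  where open ≤-Reasoning

∉-gap : ∀ {λ′} → WeaklyDecreasing λ′ → ∀ {y} → y ∉ beta λ′ → suc y < at λ′ 0 + length λ′ →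
  ∃ λ j → j < at λ′ 0 × y + column j λ′ ≡ length λ′ + j
∉-gap {x ∷ xs} (x≥ ∷ w) {y} y∉ y< with suc y <? at xs 0 + length xs
... | yes p with j , j< , e ← ∉-gap w (y∉ ∘ there) p =
  j , j<x , trans (cong (y +_) (column-accept xs j<x)) (trans (+-suc y _) (cong suc e))
  where j<x = <-≤-trans j< (at-bounded xs x≥ 0)
-- Here y lies above all beta numbers of the tail, so only the first row reaches column j and the
-- column has length 1.
... | no p = y ∸ length xs , j<x , (begin
  y + column j (x ∷ xs) ≡⟨ cong (y +_) (column-accept xs j<x) ⟩
  y + suc (column j xs) ≡⟨ cong (λ c → y + suc c) (n≤0⇒n≡0 (≮⇒≥ λ q → <-irrefl refl
                             (≤-trans (column⇒row w 0 q) head≤j))) ⟩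
  y + 1                 ≡⟨ +-comm y 1 ⟩
  suc y                 ≡⟨ cong suc y≡ ⟨
  suc (length xs + j)   ∎)
  where
  j = y ∸ length xs
  split : ∀ xs {y} → at xs 0 + length xs ≤ suc y → y ∉ beta xs → at xs 0 + length xs ≤ y
  split []       _ _  = z≤n
  split (z ∷ zs) {y} q y∉ with m≤n⇒m<n∨m≡n q
  ... | inj₁ r = ≤-pred r
  ... | inj₂ r = contradiction (here (suc-injective (trans (sym r) (+-suc z (length zs))))) y∉
  head+len≤y : at xs 0 + length xs ≤ y
  head+len≤y = split xs (≮⇒≥ p) (y∉ ∘ there)
  y≡ : length xs + j ≡ y
  y≡ = m+[n∸m]≡n (≤-trans (m≤n+m (length xs) (at xs 0)) head+len≤y)
  head≤j : at xs 0 ≤ j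
  head≤j = +-cancelʳ-≤ (length xs) _ _ (subst (at xs 0 + length xs ≤_)
    (trans (sym y≡) (+-comm (length xs) j)) head+len≤y)
  y<x+len : y < x + length xs
  y<x+len = ≤∧≢⇒< (≤-pred (subst (suc y ≤_) (+-suc x (length xs)) (<⇒≤ y<))) (y∉ ∘ here)
  j<x : j < x
  j<x = +-cancelʳ-< (length xs) _ _ (subst (_< x + length xs)
    (trans (sym y≡) (+-comm (length xs) j)) y<x+len)
  open ≡-Reasoning

-- If row i ended at or before column j, then also `column j` ≤ i, and the two equations would put x
-- below y. So every gap below a beta number comes from a cell.
gap-row : ∀ {λ′} → WeaklyDecreasing λ′ → ∀ {x y} i j →
  x + suc i ≡ at λ′ i + length λ′ → y + column j λ′ ≡ length λ′ + j → y < x → j < at λ′ i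
gap-row {λ′} w {x} {y} i j ex ey y<x = ≰⇒> λ at≤j → <-irrefl refl (begin-strict
  at λ′ i + length λ′ ≤⟨ +-monoˡ-≤ _ at≤j ⟩
  j + length λ′       ≡⟨ +-comm j _ ⟩
  length λ′ + j       ≡⟨ ey ⟨
  y + column j λ′     ≤⟨ +-monoʳ-≤ y (≮⇒≥ (λ q → <⇒≱ (column⇒row w i q) at≤j)) ⟩
  y + i               <⟨ +-mono-< y<x (n<1+n i) ⟩
  x + suc i           ≡⟨ ex ⟩
  at λ′ i + length λ′ ∎)
  where open ≤-Reasoning

-- Hook lengths as differences of beta numbers and gaps

hook : Partition → ℕ → ℕ → ℕ
hook λ′ i j = (at λ′ i ∸ suc j) + (column j λ′ ∸ suc i) + 1

hook-difference : ∀ {λ′} → WeaklyDecreasing λ′ → ∀ {x y} i j → j < at λ′ i →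
  x + suc i ≡ at λ′ i + length λ′ → y + column j λ′ ≡ length λ′ + j → x ≡ y + hook λ′ i j
hook-difference {λ′} w {x} {y} i j j< ex ey = +-cancelʳ-≡ (suc i) x _ (begin
  x + suc i                             ≡⟨ ex ⟩
  at λ′ i + length λ′                   ≡⟨ cong (_+ length λ′) p≡ ⟨
  suc j + p + length λ′                 ≡⟨ eq₁ j p (length λ′) ⟩
  length λ′ + j + suc p                 ≡⟨ cong (_+ suc p) ey ⟨
  y + column j λ′ + suc p               ≡⟨ cong (λ c → y + c + suc p) q≡ ⟨
  y + (suc i + q) + suc p               ≡⟨ eq₂ y i q p ⟩
  y + (p + q + 1) + suc i               ∎)
  where
  p = at λ′ i ∸ suc j
  q = column j λ′ ∸ suc i
  p≡ = m+[n∸m]≡n j<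
  q≡ = m+[n∸m]≡n (row⇒column w i j<)
  eq₁ : ∀ j p l → suc j + p + l ≡ l + j + suc p
  eq₁ = solve-∀
  eq₂ : ∀ y i q p → y + (suc i + q) + suc p ≡ y + (p + q + 1) + suc i
  eq₂ = solve-∀
  open ≡-Reasoning

∈-hooks⁺ : ∀ {λ′} → WeaklyDecreasing λ′ → ∀ i j → j < at λ′ i → hook λ′ i j ∈ hooks λ′
∈-hooks⁺ {λ′} w i j j< = ∈-concatMap⁺ _ (Any.map (λ { refl → inner }) (∈-upTo⁺ (row-index λ′ i j<)))
  where
  inner : hook λ′ i j ∈ map (λ j → (at λ′ i ∸ suc j) + (at (conj λ′) j ∸ suc i) + 1) (upTo (at λ′ i))
  inner = subst (_∈ map (λ j → (at λ′ i ∸ suc j) + (at (conj λ′) j ∸ suc i) + 1) (upTo (at λ′ i)))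
    (cong (λ c → (at λ′ i ∸ suc j) + (c ∸ suc i) + 1)
      (at-conj λ′ (<-≤-trans j< (row≤head w i))))
    (∈-map⁺ _ (∈-upTo⁺ j<))

∈-hooks⁻ : ∀ {λ′ h} → WeaklyDecreasing λ′ → h ∈ hooks λ′ → ∃₂ λ i j → j < at λ′ i × h ≡ hook λ′ i j
∈-hooks⁻ {λ′} w p with find (∈-concatMap⁻ _ {xs = upTo (length λ′)} p)
... | i , _ , q with j , j∈ , refl ← ∈-map⁻ _ q =
  i , j , ∈-upTo⁻ j∈ , cong (λ c → (at λ′ i ∸ suc j) + (c ∸ suc i) + 1)
      (at-conj λ′ (<-≤-trans (∈-upTo⁻ j∈) (row≤head w i)))

-- Cores and closed beta sets

Closed : ℕ → List ℕ → Set
Closed t S = ∀ x → x + t ∈ S → x ∈ S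

beta<max : ∀ {λ′ x} → WeaklyDecreasing λ′ → x ∈ beta λ′ → suc x ≤ at λ′ 0 + length λ′
beta<max {λ′} {x} w p with i , _ , e ← ∈-beta⁻ {λ′} p = begin
  suc x               ≤⟨ m≤m+n (suc x) i ⟩
  suc x + i           ≡⟨ +-suc x i ⟨
  x + suc i           ≡⟨ e ⟩
  at λ′ i + length λ′ ≤⟨ +-monoˡ-≤ _ (row≤head w i) ⟩
  at λ′ 0 + length λ′ ∎
  where open ≤-Reasoning

-- A missing y with y + t present is the gap of some column, and the cell belonging to the two has
-- hook length exactly t. The converse has to exclude all multiples of t, hence `closed-multiple`.
core⇒closed : ∀ {t λ′} → 0 < t → IsPartition λ′ → IsCore t λ′ → Closed t (beta λ′)
core⇒closed {t} {λ′} 0<t part core y y+t∈ with y ∈? beta λ′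
... | yes p = p
... | no y∉ with i , i< , ex ← ∈-beta⁻ {λ′} y+t∈
            | j , j< , ey ← ∉-gap (weaklyDecreasing part) y∉
                (<-≤-trans (s<s (m<m+n y 0<t)) (beta<max (weaklyDecreasing part) y+t∈)) =
  contradiction (subst (t ∣_) (+-cancelˡ-≡ y _ _ (hook-difference w i j j<at ex ey)) ∣-refl)
    (All.lookup core (∈-hooks⁺ w i j j<at))
  where
  w = weaklyDecreasing part
  j<at = gap-row w i j ex ey (m<m+n y 0<t)

closed-multiple : ∀ {t S} → Closed t S → ∀ k x → x + k * t ∈ S → x ∈ S
closed-multiple {S = S} c zero    x p = subst (_∈ S) (+-identityʳ x) p
closed-multiple {t} {S} c (suc k) x p =
  c x (closed-multiple c k (x + t) (subst (_∈ S) (sym (+-assoc x t (k * t))) p))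

closed⇒core : ∀ {t λ′} → IsPartition λ′ → Closed t (beta λ′) → IsCore t λ′
closed⇒core {t} {λ′} part closed = All.tabulate λ {h} h∈ t∣h → not h∈ t∣h
  where
  w = weaklyDecreasing part
  not : ∀ {h} → h ∈ hooks λ′ → ¬ (t ∣ h)
  not h∈ (divides k h≡) with i , j , j< , refl ← ∈-hooks⁻ {λ′} w h∈ =
    gap-∉ w j ey (closed-multiple closed k y
      (subst (_∈ beta λ′) (cong (y +_) h≡) (∈-beta⁺ i i< ex)))
    where
    i< = row-index λ′ i j<
    y = length λ′ + j ∸ column j λ′
    ey : y + column j λ′ ≡ length λ′ + j
    ey = m∸n+n≡m (≤-trans (column≤length j λ′) (m≤m+n _ j))
    x = at λ′ i + length λ′ ∸ suc i
    ex′ : x + suc i ≡ at λ′ i + length λ′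
    ex′ = m∸n+n≡m (≤-trans i< (m≤n+m _ (at λ′ i)))
    ex : (y + hook λ′ i j) + suc i ≡ at λ′ i + length λ′
    ex = trans (cong (_+ suc i) (sym (hook-difference w i j j< ex′ ey))) ex′

-- Partitions with a prescribed beta set

unbeta : List ℕ → Partition
unbeta []       = []
unbeta (x ∷ xs) = (x ∸ length xs) ∷ unbeta xs

length-unbeta : ∀ xs → length (unbeta xs) ≡ length xs
length-unbeta []       = refl
length-unbeta (x ∷ xs) = cong suc (length-unbeta xs)

-- The smallest entry is at least 1 and every further one is larger by at least 1. This makes the
-- truncated subtraction in `unbeta` exact and the resulting parts positive.
decreasing-length : ∀ {x} xs → Decreasing (x ∷ xs) → All (0 <_) (x ∷ xs) → length xs < x
decreasing-length []       _ (p ∷ _) = p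
decreasing-length (y ∷ ys) ((p ∷ _) ∷ d) (_ ∷ q) = ≤-<-trans (decreasing-length ys d q) p

beta-unbeta : ∀ {xs} → Decreasing xs → All (0 <_) xs → beta (unbeta xs) ≡ xs
beta-unbeta [] _ = refl
beta-unbeta {x ∷ xs} d@(_ ∷ d′) p@(_ ∷ p′) = cong₂ _∷_
  (trans (cong (x ∸ length xs +_) (length-unbeta xs)) (m∸n+n≡m (<⇒≤ (decreasing-length xs d p))))
  (beta-unbeta d′ p′)

unbeta-partition : ∀ {xs} → Decreasing xs → All (0 <_) xs → IsPartition (unbeta xs)
unbeta-partition d p = AllPairs⇒Linked (descend d p) , positive d p
  where
  positive : ∀ {xs} → Decreasing xs → All (0 <_) xs → All (0 <_) (unbeta xs)
  positive [] _ = []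
  positive {x ∷ xs} d@(_ ∷ d′) p@(_ ∷ p′) = m<n⇒0<n∸m (decreasing-length xs d p) ∷ positive d′ p′
  bounded : ∀ {x xs} → length xs < x → Decreasing (x ∷ xs) → All (0 <_) (x ∷ xs) →
            All (_≤ x ∸ length xs) (unbeta xs)
  bounded {x} {[]} _ _ _ = []
  bounded {x} {y ∷ ys} l ((y<x ∷ _) ∷ d) (_ ∷ p) =
    step ∷ All.map (λ q → ≤-trans q step) (bounded (decreasing-length ys d p) d p)
    where
    step : y ∸ length ys ≤ x ∸ suc (length ys)
    step = ∸-monoˡ-≤ (suc (length ys)) y<x
  descend : ∀ {xs} → Decreasing xs → All (0 <_) xs → AllPairs _≥_ (unbeta xs)
  descend [] _ = []
  descend {x ∷ xs} d@(_ ∷ d′) p@(_ ∷ p′) = bounded (decreasing-length xs d p) d p ∷ descend d′ p′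

-- Self-conjugacy as a symmetry of the beta set

-- With M the largest beta number, this says that x ↦ M - x exchanges beta numbers and gaps within
-- 0, ..., M.
Symmetric : ℕ → List ℕ → Set
Symmetric M S = ∀ x y → x + y ≡ M → (x ∈ S → y ∉ S) × (y ∉ S → x ∈ S)

-- The first part equals the number s of parts, so M + 1 = 2s. Row i and column i have equal length,
-- so the beta number of row i and the gap of column i add up to M.
selfConjugate⇒symmetric : ∀ {λ′ M} → IsPartition λ′ → SelfConjugate λ′ →
  suc M ≡ at λ′ 0 + length λ′ → Symmetric M (beta λ′)
selfConjugate⇒symmetric {λ′} {M} part sc M≡ x y x+y≡M = ⇒∉ , ∉⇒
  where
  w = weaklyDecreasing part
  at0≡ : at λ′ 0 ≡ length λ′
  at0≡ = trans (sym (length-conj λ′)) (cong length sc)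
  row≡column : ∀ {i} → i < length λ′ → at λ′ i ≡ column i λ′
  row≡column {i} p = trans (cong (λ μ → at μ i) (sym sc)) (at-conj λ′ (subst (i <_) (sym at0≡) p))
  sum≡ : suc (x + y) ≡ length λ′ + length λ′
  sum≡ = trans (cong suc x+y≡M) (trans M≡ (cong (_+ length λ′) at0≡))
  eq₁ : ∀ y c x i → y + c + (x + suc i) ≡ suc (x + y) + (c + i)
  eq₁ = solve-∀
  eq₂ : ∀ l c i → l + l + (c + i) ≡ l + i + (c + l)
  eq₂ = solve-∀
  ⇒∉ : x ∈ beta λ′ → y ∉ beta λ′
  ⇒∉ p with i , i< , e ← ∈-beta⁻ {λ′} p = gap-∉ w i (+-cancelʳ-≡ (x + suc i) _ _ (begin
    y + column i λ′ + (x + suc i)         ≡⟨ eq₁ y (column i λ′) x i ⟩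
    suc (x + y) + (column i λ′ + i)       ≡⟨ cong (_+ (column i λ′ + i)) sum≡ ⟩
    length λ′ + length λ′ + (column i λ′ + i) ≡⟨ eq₂ (length λ′) (column i λ′) i ⟩
    length λ′ + i + (column i λ′ + length λ′) ≡⟨ cong (λ c → length λ′ + i + (c + length λ′)) (row≡column i<) ⟨
    length λ′ + i + (at λ′ i + length λ′) ≡⟨ cong (length λ′ + i +_) e ⟨
    length λ′ + i + (x + suc i)           ∎))
    where open ≡-Reasoning
  ∉⇒ : y ∉ beta λ′ → x ∈ beta λ′
  ∉⇒ y∉ with suc y <? at λ′ 0 + length λ′
  -- This case is void: it forces y = M, which is itself a beta number. `x≡M` comes from that
  -- contradiction.
  ... | no p = ∈-beta⁺ 0 (subst (0 <_) at0≡ pos) (trans (cong (_+ 1) x≡M) (trans (+-comm M 1) M≡))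
    where
    y≡M : y ≡ M
    y≡M = ≤-antisym (subst (y ≤_) x+y≡M (m≤n+m y x)) (≤-pred (subst (_≤ suc y) (sym M≡) (≮⇒≥ p)))
    max∈ : 0 < at λ′ 0 → M ∈ beta λ′
    max∈ q = ∈-beta⁺ 0 (subst (0 <_) at0≡ q) (trans (+-comm M 1) M≡)
    pos : 0 < at λ′ 0
    pos = n≢0⇒n>0 λ e → 1+n≢0 (trans M≡ (cong₂ _+_ e (trans (sym at0≡) e)))
    x≡M : x ≡ M
    x≡M = contradiction (subst (_∈ beta λ′) (sym y≡M) (max∈ pos)) y∉
  ... | yes p with j , j< , e ← ∉-gap w y∉ p = ∈-beta⁺ j j<l (+-cancelʳ-≡ (y + column j λ′) _ _ (begin
    x + suc j + (y + column j λ′)         ≡⟨ +-comm (x + suc j) _ ⟩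
    y + column j λ′ + (x + suc j)         ≡⟨ eq₁ y (column j λ′) x j ⟩
    suc (x + y) + (column j λ′ + j)       ≡⟨ cong (_+ (column j λ′ + j)) sum≡ ⟩
    length λ′ + length λ′ + (column j λ′ + j) ≡⟨ eq₂ (length λ′) (column j λ′) j ⟩
    length λ′ + j + (column j λ′ + length λ′) ≡⟨ cong₂ _+_ e (cong (_+ length λ′) (row≡column j<l)) ⟨
    y + column j λ′ + (at λ′ j + length λ′) ≡⟨ +-comm (y + column j λ′) _ ⟩
    at λ′ j + length λ′ + (y + column j λ′) ∎))
    where
    j<l = subst (j <_) at0≡ j<
    open ≡-Reasoning

-- Since M + 1 is the first part plus the number of parts, the beta number of row j of the conjugate
-- is M minus the gap of column j. The conjugate thus has the reflected gaps as its beta set, and by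
-- symmetry these are the beta numbers of λ itself.
symmetric⇒selfConjugate : ∀ {λ′ M} → IsPartition λ′ → suc M ≡ at λ′ 0 + length λ′ →
  Symmetric M (beta λ′) → SelfConjugate λ′
symmetric⇒selfConjugate {λ′} {M} part M≡ symm = beta-injective
  (decreasing-≡ (beta-decreasing (weaklyDecreasing part′)) (beta-decreasing w) ⊆ ⊇)
  where
  w = weaklyDecreasing part
  part′ = conj-partition part
  eq : ∀ y c x j → suc (y + x) + (c + j) ≡ y + c + (x + suc j)
  eq = solve-∀
  eq′ : ∀ a l c j → a + l + (c + j) ≡ l + j + (c + a)
  eq′ = solve-∀
  ⊆ : ∀ {x} → x ∈ beta (conj λ′) → x ∈ beta λ′
  ⊆ {x} p with j , j< , e ← ∈-beta⁻ {conj λ′} p = proj₂ (symm x (M ∸ x) (m+[n∸m]≡n x≤M))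
    (gap-∉ w j (+-cancelʳ-≡ (x + suc j) _ _ (begin
      M ∸ x + column j λ′ + (x + suc j)       ≡⟨ eq (M ∸ x) (column j λ′) x j ⟨
      suc (M ∸ x + x) + (column j λ′ + j)     ≡⟨ cong (λ k → suc k + (column j λ′ + j)) (m∸n+n≡m x≤M) ⟩
      suc M + (column j λ′ + j)               ≡⟨ cong (_+ (column j λ′ + j)) M≡ ⟩
      at λ′ 0 + length λ′ + (column j λ′ + j) ≡⟨ eq′ (at λ′ 0) (length λ′) (column j λ′) j ⟩
      length λ′ + j + (column j λ′ + at λ′ 0) ≡⟨ cong (length λ′ + j +_) e″ ⟨
      length λ′ + j + (x + suc j)             ∎)))
    where
    open ≡-Reasoning
    j<a : j < at λ′ 0
    j<a = subst (j <_) (length-conj λ′) j<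
    e″ : x + suc j ≡ column j λ′ + at λ′ 0
    e″ = trans e (cong₂ _+_ (at-conj λ′ j<a) (length-conj λ′))
    x≤M : x ≤ M
    x≤M = +-cancelʳ-≤ (suc j) x M (≤-Reasoning.begin
      x + suc j ≤-Reasoning.≡⟨ e″ ⟩
      column j λ′ + at λ′ 0 ≤-Reasoning.≤⟨ +-monoˡ-≤ _ (column≤length j λ′) ⟩
      length λ′ + at λ′ 0 ≤-Reasoning.≡⟨ trans (+-comm (length λ′) _) (sym M≡) ⟩
      suc M ≤-Reasoning.≤⟨ s≤s (m≤m+n M j) ⟩
      suc (M + j) ≤-Reasoning.≡⟨ +-suc M j ⟨
      M + suc j ≤-Reasoning.∎)
  ⊇ : ∀ {x} → x ∈ beta λ′ → x ∈ beta (conj λ′)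
  ⊇ {x} p = column-member (∉-gap w y∉ y<)
    where
    x≤M : x ≤ M
    x≤M = ≤-pred (subst (suc x ≤_) (sym M≡) (beta<max w p))
    y∉ : M ∸ x ∉ beta λ′
    y∉ = proj₁ (symm x (M ∸ x) (m+[n∸m]≡n x≤M)) p
    -- The bound in `∉-gap` amounts to M - x < M, that is, to x > 0, which holds because all parts
    -- are positive.
    y< : suc (M ∸ x) < at λ′ 0 + length λ′
    y< = subst (suc (M ∸ x) <_) M≡ (s<s (∸-monoʳ-< {o = 0} (All.lookup (beta-positive (proj₂ part)) p) x≤M))
    column-member : (∃ λ j → j < at λ′ 0 × M ∸ x + column j λ′ ≡ length λ′ + j) → x ∈ beta (conj λ′)
    column-member (j , j< , e) =
      ∈-beta⁺ j (subst (j <_) (sym (length-conj λ′)) j<)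
        (trans (+-cancelˡ-≡ (M ∸ x + column j λ′) _ _ (begin
          M ∸ x + column j λ′ + (x + suc j)       ≡⟨ eq (M ∸ x) (column j λ′) x j ⟨
          suc (M ∸ x + x) + (column j λ′ + j)     ≡⟨ cong (λ k → suc k + (column j λ′ + j)) (m∸n+n≡m x≤M) ⟩
          suc M + (column j λ′ + j)               ≡⟨ cong (_+ (column j λ′ + j)) M≡ ⟩
          at λ′ 0 + length λ′ + (column j λ′ + j) ≡⟨ eq′ (at λ′ 0) (length λ′) (column j λ′) j ⟩
          length λ′ + j + (column j λ′ + at λ′ 0) ≡⟨ cong (_+ (column j λ′ + at λ′ 0)) e ⟨
          M ∸ x + column j λ′ + (column j λ′ + at λ′ 0) ∎))
        (sym (cong₂ _+_ (at-conj λ′ j<) (length-conj λ′))))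
      where open ≡-Reasoning

-- Lists without repetition

unique-injective : ∀ {f : ℕ → ℕ} {xs x y} → Unique (map f xs) → x ∈ xs → y ∈ xs → f x ≡ f y → x ≡ y
unique-injective _       (here refl) (here refl) _ = refl
unique-injective (u ∷ _) (here refl) (there q)   e = contradiction e (All.lookup u (∈-map⁺ _ q))
unique-injective (u ∷ _) (there p)   (here refl) e = contradiction (sym e) (All.lookup u (∈-map⁺ _ p))
unique-injective (_ ∷ u) (there p)   (there q)   e = unique-injective u p q e

unique-↭ : ∀ {xs ys : List ℕ} → xs ↭ ys → Unique xs → Unique ys
unique-↭ = SetoidPerm.Unique-resp-↭ (setoid ℕ) ∘ ↭⇒↭ₛ

-- Pigeonhole: the entries of `xs` are removed from `ys` one by one, and the length bound leaves
-- nothing over.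
unique-⊆-↭ : ∀ {xs ys : List ℕ} → Unique xs → (∀ {x} → x ∈ xs → x ∈ ys) →
  length ys ≤ length xs → xs ↭ ys
unique-⊆-↭ {ys = []} [] _ _ = ↭-refl
unique-⊆-↭ {x ∷ xs} (u ∷ us) sub len with as , bs , refl ← ∈-∃++ (sub (here refl)) =
  ↭-trans (prep x (unique-⊆-↭ us sub′ len′)) (↭-sym σ)
  where
  σ = Perm.shift x as bs
  sub′ : ∀ {z} → z ∈ xs → z ∈ as ++ bs
  sub′ p with ∈-resp-↭ σ (sub (there p))
  ... | here refl = contradiction refl (All.lookup u p)
  ... | there q   = q
  len′ : length (as ++ bs) ≤ length xs
  len′ = ≤-pred (subst (_≤ suc (length xs)) (Perm.↭-length σ) len)

unique-map⁻ : ∀ (f : ℕ → ℕ) {xs} → Unique (map f xs) → Unique xs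
unique-map⁻ f {[]}     []       = []
unique-map⁻ f {x ∷ xs} (u ∷ us) = All.tabulate (λ p e → All.lookup u (∈-map⁺ f p) (cong f e)) ∷ unique-map⁻ f us

unique-map⁺ : ∀ (f g : ℕ → ℕ) {xs} → All (λ x → g (f x) ≡ x) xs → Unique xs → Unique (map f xs)
unique-map⁺ f g {xs} a u = unique-map⁻ g
  (subst Unique (trans (sym (map-id-local a)) (map-∘ xs)) u)

∈⇒≤sum : ∀ {x xs} → x ∈ xs → x ≤ sum xs
∈⇒≤sum (here refl) = m≤m+n _ _
∈⇒≤sum {xs = y ∷ _} (there p) = ≤-trans (∈⇒≤sum p) (m≤n+m _ y)

squares : List ℕ → ℕ
squares xs = sum (map (λ x → x * x) xs)

-- Runners, thresholds and the size of a core

module Abacus (t : ℕ) .{{_ : NonZero t}} where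

  runner : ℕ → List ℕ → List ℕ
  runner r S = filter (λ x → x % t ≟ r) S

  count : ℕ → List ℕ → ℕ
  count r S = length (runner r S)

  -- The first vacant position on the runner of residue r.
  threshold : List ℕ → ℕ → ℕ
  threshold S r = count r S * t + r

  progression : ℕ → ℕ → List ℕ
  progression r zero    = []
  progression r (suc m) = (m * t + r) ∷ progression r m

  ∈-progression⁺ : ∀ r {q m} → q < m → q * t + r ∈ progression r m
  ∈-progression⁺ r {q} {suc m} p with m≤n⇒m<n∨m≡n (≤-pred p)
  ... | inj₁ q<m  = there (∈-progression⁺ r q<m)
  ... | inj₂ refl = here refl

  ∈-progression⁻ : ∀ r {x} m → x ∈ progression r m → ∃ λ q → q < m × x ≡ q * t + r
  ∈-progression⁻ r (suc m) (here refl) = m , n<1+n m , refl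
  ∈-progression⁻ r (suc m) (there p) with q , q<m , e ← ∈-progression⁻ r m p =
    q , m<n⇒m<1+n q<m , e

  division : ∀ x → x ≡ x / t * t + x % t
  division x = trans (m≡m%n+[m/n]*n x t) (+-comm (x % t) _)

  residue : ∀ q {r} → r < t → (q * t + r) % t ≡ r
  residue q {r} r<t = trans (cong (_% t) (+-comm (q * t) r))
    (trans ([m+kn]%n≡m%n r q t) (m<n⇒m%n≡m r<t))

  -- Let k be the number of entries after the largest. By induction they occupy the quotients 0,
  -- ..., k - 1. The quotient of the largest entry is not below k, as it would be taken already, and
  -- not above k, as closedness puts the entry t below it among the others.
  closed-progression : ∀ {r S} → Decreasing S → All (λ x → x % t ≡ r) S → Closed t S →
    S ≡ progression r (length S)
  closed-progression [] _ _ = refl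
  closed-progression {r} {x ∷ xs} (x> ∷ d) (x%t ∷ a) closed = cong₂ _∷_ x≡ ih
    where
    k = length xs
    below : ∀ {z} → z ∈ x ∷ xs → z < x → z ∈ xs
    below (here refl) z<z = contradiction z<z (<-irrefl refl)
    below (there p)   _   = p
    shrink : ∀ y → y < y + t
    shrink y = m<m+n y (>-nonZero⁻¹ t)
    ih : xs ≡ progression r k
    ih = closed-progression d a λ y p →
      below (closed y (there p)) (<-trans (shrink y) (All.lookup x> p))
    x≡q : x ≡ x / t * t + r
    x≡q = trans (division x) (cong (x / t * t +_) x%t)
    x≡ : x ≡ k * t + r
    x≡ with <-cmp (x / t) k
    ... | tri≈ _ e _ = trans x≡q (cong (λ q → q * t + r) e)
    ... | tri< q<k _ _ = contradiction
      (All.lookup x> (subst₂ _∈_ (sym x≡q) (sym ih) (∈-progression⁺ r q<k))) (<-irrefl refl)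
    ... | tri> _ _ k<q with x / t | x≡q
    ... | suc q | e with ∈-progression⁻ r k (subst (q * t + r ∈_) ih (below (closed (q * t + r) (here e′)) q<x))
      where
      e′ : q * t + r + t ≡ x
      e′ = trans (trans (+-comm (q * t + r) t) (sym (+-assoc t (q * t) r))) (sym e)
      q<x : q * t + r < x
      q<x = subst (q * t + r <_) e′ (shrink _)
    ... | q′ , q′<k , e″ = contradiction k<q (≤⇒≯ (subst (_< k)
      (sym (*-cancelʳ-≡ q q′ t (+-cancelʳ-≡ r _ _ e″))) q′<k))

  runner-progression : ∀ {S} r → Decreasing S → Closed t S → runner r S ≡ progression r (count r S)
  runner-progression {S} r d closed = closed-progression
    (AllPairs.filter⁺ (λ x → x % t ≟ r) d)
    (All.tabulate λ p → proj₂ (∈-filter⁻ (λ x → x % t ≟ r) {xs = S} p))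
    λ y p → let q , e = ∈-filter⁻ (λ x → x % t ≟ r) {xs = S} p in
      ∈-filter⁺ (λ x → x % t ≟ r) (closed y q) (trans (sym ([m+n]%n≡m%n y t)) e)

  module _ {S : List ℕ} (d : Decreasing S) (closed : Closed t S) where

    ∈⇒<threshold : ∀ {x} → x ∈ S → x < threshold S (x % t)
    ∈⇒<threshold {x} p with q , q< , e ← ∈-progression⁻ (x % t) (count (x % t) S)
      (subst (x ∈_) (runner-progression (x % t) d closed) (∈-filter⁺ (λ y → y % t ≟ x % t) p refl)) =
      subst (_< threshold S (x % t)) (sym e) (+-monoˡ-< (x % t) (*-monoˡ-< t q<))

    <threshold⇒∈ : ∀ {x} → x < threshold S (x % t) → x ∈ S
    <threshold⇒∈ {x} p = proj₁ (∈-filter⁻ (λ y → y % t ≟ x % t) {xs = S}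
      (subst₂ _∈_ (sym (division x)) (sym (runner-progression (x % t) d closed))
        (∈-progression⁺ (x % t) (*-cancelʳ-< t (x / t) (count (x % t) S)
          (+-cancelʳ-< (x % t) _ _ (subst (_< threshold S (x % t)) (division x) p))))))

    threshold-residue : ∀ {r} → r < t → threshold S r % t ≡ r
    threshold-residue = residue (count _ S)

    threshold-unique : ∀ {r c} → r < t → c % t ≡ r →
      (∀ {x} → x % t ≡ r → x ∈ S → x < c) → (∀ {x} → x % t ≡ r → x < c → x ∈ S) →
      threshold S r ≡ c
    threshold-unique {r} {c} r<t c%t f g with <-cmp (threshold S r) c
    ... | tri≈ _ e _ = e
    ... | tri< p _ _ = contradiction
      (subst (λ r → threshold S _ < threshold S r) (threshold-residue r<t)
        (∈⇒<threshold (g (threshold-residue r<t) p))) (<-irrefl refl)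
    ... | tri> _ _ p = contradiction
      (f c%t (<threshold⇒∈ (subst (λ r → c < threshold S r) (sym c%t) p))) (<-irrefl refl)

  threshold-injective : ∀ {S S′} → Decreasing S → Closed t S → Decreasing S′ → Closed t S′ →
    (∀ {r} → r < t → threshold S r ≡ threshold S′ r) → S ≡ S′
  threshold-injective {S} {S′} d c d′ c′ e = decreasing-≡ d d′
    (λ {x} p → <threshold⇒∈ d′ c′ (subst (x <_) (e (m%n<n x t)) (∈⇒<threshold d c p)))
    (λ {x} p → <threshold⇒∈ d c (subst (x <_) (sym (e (m%n<n x t))) (∈⇒<threshold d′ c′ p)))

  -- Stated as a permutation so that sums over `D` can be transported to sums over the residues.
  CompleteResidues : List ℕ → Set
  CompleteResidues D = map (_% t) D ↭ upTo t

  complete-unique : ∀ {D} → CompleteResidues D → Unique (map (_% t) D)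
  complete-unique p = unique-↭ (↭-sym p) (upTo⁺ t)

  complete-∈ : ∀ {D} → CompleteResidues D → ∀ {r} → r < t → ∃ λ x → x ∈ D × r ≡ x % t
  complete-∈ p r<t = ∈-map⁻ (_% t) (∈-resp-↭ (↭-sym p) (∈-upTo⁺ r<t))

  unique⇒complete : ∀ {D} → Unique (map (_% t) D) → length D ≡ t → CompleteResidues D
  unique⇒complete {D} u len = unique-⊆-↭ u
    (λ p → let x , _ , e = ∈-map⁻ (_% t) p in subst (_∈ upTo t) (sym e) (∈-upTo⁺ (m%n<n x t)))
    (≤-reflexive (trans (length-upTo t) (sym (trans (length-map (_% t) D) len))))

  -- Each entry names its own residue class, so `D` may list the thresholds in any order.
  Thresholds : List ℕ → List ℕ → Set
  Thresholds S D = All (λ x → threshold S (x % t) ≡ x) D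

  thresholds-↭ : ∀ {S D} → CompleteResidues D → Thresholds S D → D ↭ map (threshold S) (upTo t)
  thresholds-↭ {S} {D} p a = subst (_↭ map (threshold S) (upTo t))
    (trans (sym (map-∘ D)) (map-id-local a)) (Perm.map⁺ (threshold S) p)

  thresholds-⊆ : ∀ {S D D′} → Thresholds S D → Thresholds S D′ → CompleteResidues D′ →
    ∀ {x} → x ∈ D → x ∈ D′
  thresholds-⊆ {S} {D} {D′} thr thr′ complete′ {x} x∈D
    with x′ , x′∈D′ , e ← complete-∈ complete′ (m%n<n x t) = subst (_∈ D′) x′≡x x′∈D′
    where
    x′≡x : x′ ≡ x
    x′≡x = trans (sym (All.lookup thr′ x′∈D′)) (trans (cong (threshold S) (sym e)) (All.lookup thr x∈D))

  -- The set consists of all x below the entry of `D` congruent to x; as entries are at most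
  -- `sum D`, a search below that bound finds all of it. The entry 0 of `D` keeps 0 out of the set,
  -- so that the parts of the partition will be positive.
  beta-with-thresholds : ∀ {D} → CompleteResidues D → 0 ∈ D →
    ∃ λ S → Decreasing S × All (0 <_) S × Closed t S × Thresholds S D
  beta-with-thresholds {D} complete 0∈D = S , d , All.tabulate positive , closed , All.tabulate thr
    where
    P : ℕ → Set
    P x = Any (λ c → x % t ≡ c % t × x < c) D
    P? : ∀ x → Dec (P x)
    P? x = any? (λ c → (x % t ≟ c % t) ×-dec (x <? c)) D
    S = filter P? (downFrom (sum D))
    S⁺ : ∀ {x} → P x → x ∈ S
    S⁺ {x} p = let c , c∈ , _ , x<c = find p in
      ∈-filter⁺ P? (∈-downFrom⁺ (<-≤-trans x<c (∈⇒≤sum c∈))) p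
    S⁻ : ∀ {x} → x ∈ S → P x
    S⁻ p = proj₂ (∈-filter⁻ P? {xs = downFrom (sum D)} p)
    d : Decreasing S
    d = AllPairs.filter⁺ P? (AllPairs.applyDownFrom⁺₁ id (sum D) (λ j<i _ → j<i))
    closed : Closed t S
    closed x p = S⁺ (Any.map (λ (e , l) → trans (sym ([m+n]%n≡m%n x t)) e , ≤-<-trans (m≤m+n x t) l) (S⁻ p))
    same : ∀ {c c′} → c ∈ D → c′ ∈ D → c % t ≡ c′ % t → c ≡ c′
    same = unique-injective (complete-unique complete)
    positive : ∀ {x} → x ∈ S → 0 < x
    positive {zero} p = let c , c∈ , e , 0<c = find (S⁻ p) in
      contradiction (subst (0 <_) (same c∈ 0∈D (sym e)) 0<c) (<-irrefl refl)
    positive {suc x} p = z<s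
    thr : ∀ {c} → c ∈ D → threshold S (c % t) ≡ c
    thr {c} c∈ = threshold-unique d closed (m%n<n c t) refl
      (λ {x} e p → let c′ , c′∈ , e′ , x<c′ = find (S⁻ p) in
        subst (x <_) (same c′∈ c∈ (trans (sym e′) e)) x<c′)
      (λ e p → S⁺ (lose c∈ (e , p)))

  -- The sum in terms of the next term c = m t + r, cleared of the denominator 2t and of subtractions.
  sum-progression : ∀ r m → 2 * (t * sum (progression r m)) + t * (m * t + r) + r * r
                          ≡ (m * t + r) * (m * t + r) + t * r
  sum-progression r zero = eq t r
    where
    eq : ∀ t r → 2 * (t * 0) + t * r + r * r ≡ r * r + t * r
    eq = solve-∀
  sum-progression r (suc m) = trans (eq₁ t r (m * t) (sum (progression r m)))
    (trans (cong (_+ (2 * (t * (m * t + r)) + t * t)) (sum-progression r m)) (eq₂ t r (m * t)))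
    where
    eq₁ : ∀ t r a s → 2 * (t * (a + r + s)) + t * (t + a + r) + r * r
                    ≡ 2 * (t * s) + t * (a + r) + r * r + (2 * (t * (a + r)) + t * t)
    eq₁ = solve-∀
    eq₂ : ∀ t r a → (a + r) * (a + r) + t * r + (2 * (t * (a + r)) + t * t)
                  ≡ (t + a + r) * (t + a + r) + t * r
    eq₂ = solve-∀

  -- `W` is an additive weight, later `length` and `sum`. Every number lies on exactly one runner,
  -- so the weights of the runners add up to the weight of the list.
  module _ (W : List ℕ → ℕ) (w : ℕ → ℕ) (W[] : W [] ≡ 0) (W∷ : ∀ x xs → W (x ∷ xs) ≡ w x + W xs) where

    private
      total : List ℕ → List ℕ → ℕ
      total R S = sum (map (λ r → W (runner r S)) R)

      total-∉ : ∀ {R x} S → x % t ∉ R → total R (x ∷ S) ≡ total R S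
      total-∉ {[]} S _ = refl
      total-∉ {r ∷ R} {x} S r∉ = cong₂ _+_
        (cong W (filter-reject (λ x → x % t ≟ r) {xs = S} (r∉ ∘ here))) (total-∉ {R} S (r∉ ∘ there))

      total-∈ : ∀ {R x} S → Unique R → x % t ∈ R → total R (x ∷ S) ≡ w x + total R S
      total-∈ {r ∷ R} {x} S (u ∷ _) (here refl) = trans (cong₂ _+_
        (trans (cong W (filter-accept (λ y → y % t ≟ x % t) {xs = S} refl)) (W∷ x _))
        (total-∉ S λ p → All.lookup u p refl)) (+-assoc (w x) _ _)
      total-∈ {r ∷ R} {x} S (u ∷ us) (there p) = trans (cong₂ _+_
        (cong W (filter-reject (λ y → y % t ≟ r) {xs = S} λ e → All.lookup u p (sym e)))
        (total-∈ S us p)) (eq (W (runner r S)) (w x) (total R S))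
        where
        eq : ∀ a b c → a + (b + c) ≡ b + (a + c)
        eq = solve-∀

      total-[] : ∀ R → total R [] ≡ 0
      total-[] []      = refl
      total-[] (r ∷ R) = cong₂ _+_ W[] (total-[] R)

    sum-runners : ∀ S → total (upTo t) S ≡ W S
    sum-runners []      = trans (total-[] (upTo t)) (sym W[])
    sum-runners (x ∷ S) = trans (total-∈ S (upTo⁺ t) (∈-upTo⁺ (m%n<n x t)))
      (trans (cong (w x +_) (sum-runners S)) (sym (W∷ x S)))

  module _ {S : List ℕ} (d : Decreasing S) (closed : Closed t S) where

    private
      Σ : (ℕ → ℕ) → List ℕ → ℕ
      Σ f R = sum (map f R)

      sums : ∀ R → 2 * (t * Σ (λ r → sum (runner r S)) R) + t * sum (map (threshold S) R) + squares R
                 ≡ squares (map (threshold S) R) + t * sum R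
      sums [] = eq t
        where
        eq : ∀ t → 2 * (t * 0) + t * 0 + 0 ≡ t * 0
        eq = solve-∀
      sums (r ∷ R) = begin
        2 * (t * (sum (runner r S) + s)) + t * (c + cs) + (r * r + rr)
          ≡⟨ cong (λ l → 2 * (t * (sum l + s)) + t * (c + cs) + (r * r + rr)) (runner-progression r d closed) ⟩
        2 * (t * (p + s)) + t * (c + cs) + (r * r + rr)
          ≡⟨ eq₁ t p s c cs (r * r) rr ⟩
        (2 * (t * p) + t * c + r * r) + (2 * (t * s) + t * cs + rr)
          ≡⟨ cong₂ _+_ (sum-progression r (count r S)) (sums R) ⟩
        (c * c + t * r) + (cc + t * sum R)
          ≡⟨ eq₂ (c * c) cc t r (sum R) ⟩
        (c * c + cc) + t * (r + sum R) ∎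
        where
        open ≡-Reasoning
        s = Σ (λ r → sum (runner r S)) R
        p = sum (progression r (count r S))
        c = threshold S r
        cs = sum (map (threshold S) R)
        cc = squares (map (threshold S) R)
        rr = squares R
        eq₁ : ∀ t p s c cs r rr → 2 * (t * (p + s)) + t * (c + cs) + (r + rr)
            ≡ (2 * (t * p) + t * c + r) + (2 * (t * s) + t * cs + rr)
        eq₁ = solve-∀
        eq₂ : ∀ c cc t r rs → (c + t * r) + (cc + t * rs) ≡ (c + cc) + t * (r + rs)
        eq₂ = solve-∀

      counts : ∀ R → t * Σ (λ r → count r S) R + sum R ≡ sum (map (threshold S) R)
      counts [] = trans (+-identityʳ _) (*-zeroʳ t)
      counts (r ∷ R) = trans (eq t (count r S) (Σ (λ r → count r S) R) r (sum R))
                             (cong (threshold S r +_) (counts R))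
        where
        eq : ∀ t a b r s → t * (a + b) + (r + s) ≡ (a * t + r) + (t * b + s)
        eq = solve-∀

    sum-thresholds : t * length S + sum (upTo t) ≡ sum (map (threshold S) (upTo t))
    sum-thresholds = trans
      (cong (λ l → t * l + sum (upTo t)) (sym (sum-runners length (const 1) refl (λ _ _ → refl) S)))
      (counts (upTo t))

    squares-thresholds : 2 * (t * sum S) + t * sum (map (threshold S) (upTo t)) + squares (upTo t)
                       ≡ squares (map (threshold S) (upTo t)) + t * sum (upTo t)
    squares-thresholds = trans
      (cong (λ s → 2 * (t * s) + t * sum (map (threshold S) (upTo t)) + squares (upTo t))
        (sym (sum-runners sum id refl (λ _ _ → refl) S)))
      (sums (upTo t))

  -- The shifts added to the l parts are 0, ..., l - 1, with sum l(l - 1)/2.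
  sum-beta : ∀ λ′ → 2 * sum (beta λ′) + length λ′ ≡ 2 * size λ′ + length λ′ * length λ′
  sum-beta [] = refl
  sum-beta (x ∷ xs) = trans (eq₁ x (length xs) (sum (beta xs)))
    (trans (cong (_+ (2 * x + 2 * length xs + 1)) (sum-beta xs)) (eq₂ x (length xs) (sum xs)))
    where
    eq₁ : ∀ x l s → 2 * (x + l + s) + suc l ≡ 2 * s + l + (2 * x + 2 * l + 1)
    eq₁ = solve-∀
    eq₂ : ∀ x l s → 2 * s + l * l + (2 * x + 2 * l + 1) ≡ 2 * (x + s) + suc l * suc l
    eq₂ = solve-∀

  -- The sum of the beta numbers is eliminated between t² times `sum-beta` and t times
  -- `squares-thresholds`. With these factors the number of parts occurs only through `u`, which the
  -- first component expresses by `sum D`.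
  core-size : ∀ {λ′ D} → IsPartition λ′ → Closed t (beta λ′) → CompleteResidues D → Thresholds (beta λ′) D →
    let u = t * length λ′ in sum D ≡ u + sum (upTo t) ×
      2 * (t * t) * size λ′ + u * u + t * t * sum D + t * squares (upTo t)
        ≡ t * squares D + t * t * sum (upTo t) + t * u
  core-size {λ′} {D} part closed complete thr = sym S≡ , main
    where
    d = beta-decreasing (weaklyDecreasing part)
    ρ = sum (upTo t)
    ρ₂ = squares (upTo t)
    l = length λ′
    u = t * l
    perm = thresholds-↭ {beta λ′} complete thr
    sumD = sum-↭ perm
    sqD : squares D ≡ squares (map (threshold (beta λ′)) (upTo t))
    sqD = sum-↭ (Perm.map⁺ (λ x → x * x) perm)
    S≡ : u + ρ ≡ sum D
    S≡ = trans (cong (λ l → t * l + ρ) (sym (length-beta λ′))) (trans (sum-thresholds d closed) (sym sumD))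
    Q≡ : 2 * (t * sum (beta λ′)) + t * sum D + ρ₂ ≡ squares D + t * ρ
    Q≡ = trans (cong (λ s → 2 * (t * sum (beta λ′)) + t * s + ρ₂) sumD)
      (trans (squares-thresholds d closed) (cong (_+ t * ρ) (sym sqD)))
    eq₁ : ∀ t n l S ρ₂ → 2 * (t * t) * n + (t * l) * (t * l) + t * t * S + t * ρ₂
        ≡ t * t * (2 * n + l * l) + t * t * S + t * ρ₂
    eq₁ = solve-∀
    eq₂ : ∀ t b l S ρ₂ → t * t * (2 * b + l) + t * t * S + t * ρ₂
        ≡ t * (2 * (t * b) + t * S + ρ₂) + t * (t * l)
    eq₂ = solve-∀
    eq₃ : ∀ t Q ρ u → t * (Q + t * ρ) + t * u ≡ t * Q + t * t * ρ + t * u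
    eq₃ = solve-∀
    main : 2 * (t * t) * size λ′ + u * u + t * t * sum D + t * ρ₂ ≡ t * squares D + t * t * ρ + t * u
    main = begin
      2 * (t * t) * size λ′ + u * u + t * t * sum D + t * ρ₂
        ≡⟨ eq₁ t (size λ′) l (sum D) ρ₂ ⟩
      t * t * (2 * size λ′ + l * l) + t * t * sum D + t * ρ₂
        ≡⟨ cong (λ k → t * t * k + t * t * sum D + t * ρ₂) (sum-beta λ′) ⟨
      t * t * (2 * sum (beta λ′) + l) + t * t * sum D + t * ρ₂
        ≡⟨ eq₂ t (sum (beta λ′)) l (sum D) ρ₂ ⟩
      t * (2 * (t * sum (beta λ′)) + t * sum D + ρ₂) + t * u
        ≡⟨ cong (λ k → t * k + t * u) Q≡ ⟩
      t * (squares D + t * ρ) + t * u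
        ≡⟨ eq₃ t (squares D) ρ u ⟩
      t * squares D + t * t * ρ + t * u ∎
      where open ≡-Reasoning

max-∈-beta : ∀ {λ′ M} → 0 < length λ′ → suc M ≡ at λ′ 0 + length λ′ → M ∈ beta λ′
max-∈-beta {λ′} {M} p e = ∈-beta⁺ 0 p (trans (+-comm M 1) e)

-- Reflection of the thresholds

module Reflection (t : ℕ) .{{_ : NonZero t}} where

  open Abacus t

  congruent-≤ : ∀ {x c} → x ≤ c → x % t ≡ c % t → ∃ λ k → c ≡ x + k * t
  congruent-≤ {x} {c} x≤c e = c / t ∸ x / t , (begin
    c                                       ≡⟨ m≡m%n+[m/n]*n c t ⟩
    c % t + c / t * t                       ≡⟨ cong₂ (λ r q → r + q * t) (sym e) (sym (m+[n∸m]≡n (/-monoˡ-≤ t x≤c))) ⟩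
    x % t + (x / t + (c / t ∸ x / t)) * t   ≡⟨ eq (x % t) (x / t) (c / t ∸ x / t) t ⟩
    x % t + x / t * t + (c / t ∸ x / t) * t ≡⟨ cong (_+ (c / t ∸ x / t) * t) (sym (m≡m%n+[m/n]*n x t)) ⟩
    x + (c / t ∸ x / t) * t                 ∎)
    where
    open ≡-Reasoning
    eq : ∀ r a b t → r + (a + b) * t ≡ r + a * t + b * t
    eq = solve-∀

  congruent-< : ∀ {x c} → x < c → x % t ≡ c % t → ∃ λ k → c ≡ x + (t + k * t)
  congruent-< {x} {c} x<c e with congruent-≤ (<⇒≤ x<c) e
  ... | zero  , e′ = contradiction (trans e′ (+-identityʳ x)) (≢-sym (<⇒≢ x<c))
  ... | suc k , e′ = k , e′

  +-cancelˡ-% : ∀ a {b c} → (a + b) % t ≡ (a + c) % t → b % t ≡ c % t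
  +-cancelˡ-% a {b} {c} e = begin
    b % t                       ≡⟨ shifted b ⟨
    (k + (a + b)) % t           ≡⟨ %-distribˡ-+ k (a + b) t ⟩
    (k % t + (a + b) % t) % t   ≡⟨ cong (λ r → (k % t + r) % t) e ⟩
    (k % t + (a + c) % t) % t   ≡⟨ %-distribˡ-+ k (a + c) t ⟨
    (k + (a + c)) % t           ≡⟨ shifted c ⟩
    c % t                       ∎
    where
    open ≡-Reasoning
    -- This represents -a modulo t, since k + a is a multiple of t.
    k = a * t ∸ a
    shifted : ∀ b → (k + (a + b)) % t ≡ b % t
    shifted b = trans (cong (_% t) (trans (sym (+-assoc k a b))
      (trans (cong (_+ b) (m∸n+n≡m (m≤m*n a t))) (+-comm (a * t) b)))) ([m+kn]%n≡m%n b a t)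

  -- Let c be the threshold of the class of x and c′ = A - c. As x + y = A - t, the number y is in
  -- the class of c′. Now x < c means x ≤ c - t, that is y ≥ c′, so that y is missing; and x ≥ c
  -- means y ≤ c′ - t, so that y is present.
  reflect-symmetric : ∀ {S D A M} → Decreasing S → Closed t S →
    CompleteResidues D → Thresholds S D → (∀ {c} → c ∈ D → ∃ λ c′ → c′ ∈ D × c + c′ ≡ A) →
    M + t ≡ A → Symmetric M S
  reflect-symmetric {S} {D} {A} {M} d closed complete thr reflect M≡ x y x+y≡M =
    let c , c∈ , x≡c = complete-∈ complete (m%n<n x t)
        c′ , c′∈ , c+c′ = reflect c∈
    in pair c∈ c′∈ x≡c (trans c+c′ (trans (sym M≡) (cong (_+ t) (sym x+y≡M))))
    where
    threshold-at : ∀ {z c} → c ∈ D → z % t ≡ c % t → threshold S (z % t) ≡ c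
    threshold-at c∈ e = trans (cong (threshold S) e) (All.lookup thr c∈)
    eq₁ : ∀ x k t c → (x + (t + k * t)) + c ≡ (c + k * t) + (x + t)
    eq₁ = solve-∀
    eq₂ : ∀ x y t → x + y + t ≡ y + (x + t)
    eq₂ = solve-∀
    eq₃ : ∀ c y k t → (c + k * t) + y + t ≡ c + (y + (t + k * t))
    eq₃ = solve-∀
    pair : ∀ {c c′} → c ∈ D → c′ ∈ D → x % t ≡ c % t → c + c′ ≡ x + y + t →
      (x ∈ S → y ∉ S) × (y ∉ S → x ∈ S)
    pair {c} {c′} c∈ c′∈ x≡c c+c′ = ⇒∉ , ∉⇒
      where
      below : x < c → ∃ λ k → y ≡ c′ + k * t
      below p = let k , e = congruent-< p x≡c in k , +-cancelʳ-≡ (x + t) _ _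
        (trans (sym (eq₂ x y t)) (trans (sym c+c′) (trans (cong (_+ c′) e) (eq₁ x k t c′))))
      above : c ≤ x → ∃ λ k → c′ ≡ y + (t + k * t)
      above p = let k , e = congruent-≤ p (sym x≡c) in k , +-cancelˡ-≡ c _ _
        (trans c+c′ (trans (cong (λ x → x + y + t) e) (eq₃ c y k t)))
      ⇒∉ : x ∈ S → y ∉ S
      ⇒∉ p q =
        let k , e = below (subst (x <_) (threshold-at c∈ x≡c) (∈⇒<threshold d closed p))
            y≡c′ = trans (cong (_% t) e) ([m+kn]%n≡m%n c′ k t)
        in <⇒≱ (subst (y <_) (threshold-at c′∈ y≡c′) (∈⇒<threshold d closed q))
               (subst (c′ ≤_) (sym e) (m≤m+n c′ (k * t)))
      ∉⇒ : y ∉ S → x ∈ S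
      ∉⇒ y∉ with <-≤-connex x c
      ... | inj₁ x<c = <threshold⇒∈ d closed (subst (x <_) (sym (threshold-at c∈ x≡c)) x<c)
      ... | inj₂ c≤x =
        let k , e = above c≤x
            y≡c′ = trans (sym ([m+kn]%n≡m%n y (suc k) t)) (cong (_% t) (sym e))
        in contradiction (<threshold⇒∈ d closed (subst (y <_) (sym (threshold-at c′∈ y≡c′))
             (subst (y <_) (sym e) (m<m+n y (<-≤-trans (>-nonZero⁻¹ t) (m≤m+n t _)))))) y∉

  -- With c the threshold of class i, the number M + t - c passes the test of `threshold-unique` for
  -- class j: a number below it reflects to one that is at least c, a gap, and a number from it
  -- onwards up to M reflects to one below c, a beta number.
  symmetric-thresholds : ∀ {S M i j} → Decreasing S → Closed t S → Symmetric M S → (∀ {x} → x ∈ S → x ≤ M) →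
    i < t → j < t → (i + j) % t ≡ (M + t) % t → threshold S i + threshold S j ≡ M + t
  symmetric-thresholds {S} {M} {i} {j} d closed symm max i<t j<t i+j = trans
    (cong (c +_) (threshold-unique d closed j<t c′%t f g)) c+c′
    where
    c = threshold S i
    c%t : c % t ≡ i
    c%t = threshold-residue d closed i<t
    c≤ : c ≤ M + t
    -- If c ≥ t then c - t is a beta number and hence at most M.
    c≤ with <-≤-connex c t
    ... | inj₁ c<t = ≤-trans (<⇒≤ c<t) (m≤n+m t M)
    ... | inj₂ t≤c = subst (_≤ M + t) (m∸n+n≡m t≤c) (+-monoˡ-≤ t (max
      (<threshold⇒∈ d closed (subst (λ r → c ∸ t < threshold S r) (sym r≡)
        (∸-monoʳ-< {o = 0} (>-nonZero⁻¹ t) t≤c)))))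
      where
      r≡ : (c ∸ t) % t ≡ i
      r≡ = trans (sym ([m+n]%n≡m%n (c ∸ t) t)) (trans (cong (_% t) (m∸n+n≡m t≤c)) c%t)
    c′ = M + t ∸ c
    c+c′ : c + c′ ≡ M + t
    c+c′ = m+[n∸m]≡n c≤
    c′%t : c′ % t ≡ j
    c′%t = trans (+-cancelˡ-% c {c′} {j} (trans (cong (_% t) c+c′) (trans (sym i+j)
      (trans (%-distribˡ-+ i j t) (trans (cong (λ r → (r + j % t) % t) (trans (m<n⇒m%n≡m i<t) (sym c%t)))
        (sym (%-distribˡ-+ c j t)))))))
      (m<n⇒m%n≡m j<t)
    eq₁ : ∀ c k t y → (c + k * t + y) + t ≡ c + (y + (t + k * t))
    eq₁ = solve-∀
    eq₃ : ∀ x c k t → (x + (t + k * t)) + c ≡ (x + (c + k * t)) + t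
    eq₃ = solve-∀
    g : ∀ {y} → y % t ≡ j → y < c′ → y ∈ S
    g {y} y%t y<c′ = let k , e = congruent-< y<c′ (trans y%t (sym c′%t)) in
      proj₂ (symm y (c + k * t) (trans (+-comm y _) (+-cancelʳ-≡ t _ _
        (trans (eq₁ c k t y) (trans (cong (c +_) (sym e)) c+c′)))))
        λ p → <⇒≱ (subst (λ r → c + k * t < threshold S r) (trans ([m+kn]%n≡m%n c k t) c%t)
                    (∈⇒<threshold d closed p)) (m≤m+n c (k * t))
    f : ∀ {y} → y % t ≡ j → y ∈ S → y < c′
    f {y} y%t y∈ with <-≤-connex y c′
    ... | inj₁ p = p
    ... | inj₂ c′≤y =
      let k , e = congruent-≤ c′≤y (trans c′%t (sym y%t))
          x = M ∸ y
          c≡ : c ≡ x + (t + k * t)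
          c≡ = +-cancelʳ-≡ c′ _ _ (trans c+c′ (trans (cong (_+ t) (trans (sym (m∸n+n≡m (max y∈))) (cong (x +_) e)))
            (sym (eq₃ x c′ k t))))
          x%t : x % t ≡ i
          x%t = trans (sym ([m+kn]%n≡m%n x (suc k) t)) (trans (cong (_% t) (sym c≡)) c%t)
      in contradiction (<threshold⇒∈ d closed (subst (λ r → x < threshold S r) (sym x%t)
        (subst (x <_) (sym c≡) (m<m+n x (<-≤-trans (>-nonZero⁻¹ t) (m≤m+n t _))))))
        (proj₁ (symm y x (m+[n∸m]≡n (max y∈))) y∈)

-- Residue conditions modulo 7 and modulo 4

-- Here h = d + g + f and e = d + g, so that norm = h² + d² + e² and
-- canonical = [ 2h , h + e , h + d , h , h − d , h − e , 0 ].
norm : ℕ → ℕ → ℕ → ℕ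
norm d g f = (d + g + f) * (d + g + f) + d * d + (d + g) * (d + g)

canonical : ℕ → ℕ → ℕ → List ℕ
canonical d g f = 2 * (d + g + f) ∷ (2 * d + 2 * g + f) ∷ (2 * d + g + f) ∷ (d + g + f)
                ∷ (g + f) ∷ f ∷ 0 ∷ []

smallest : Bool → ℕ → ℕ → ℕ
smallest true  d g = 2 * d + g
smallest false d g = g

-- The middle entry is h + d for true and h − d for false, and y + z − x = 2h in both cases.
triple : Bool → ℕ → ℕ → ℕ → List ℕ
triple b d g f = smallest b d g ∷ smallest b d g + f ∷ (2 * d + 2 * g + f) ∷ []

-- Consecutive entries differ by f, g, d, d, g, f.
canonical-decreasing : ∀ {d g f} → 0 < d → 0 < g → 0 < f → Decreasing (canonical d g f)
canonical-decreasing {d} {g} {f} 0<d 0<g 0<f = Linked⇒AllPairs (λ p q → <-trans q p)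
  ( step f (eq₁ d g f) 0<f ∷ step g (eq₂ d g f) 0<g ∷ step d (eq₃ d g f) 0<d
  ∷ step d (eq₄ d g f) 0<d ∷ step g (+-comm g f) 0<g ∷ 0<f ∷ [-])
  where
  step : ∀ {m n} k → m ≡ n + k → 0 < k → n < m
  step {n = n} k e p = subst (n <_) (sym e) (m<m+n n p)
  eq₁ : ∀ d g f → 2 * (d + g + f) ≡ 2 * d + 2 * g + f + f
  eq₁ = solve-∀
  eq₂ : ∀ d g f → 2 * d + 2 * g + f ≡ 2 * d + g + f + g
  eq₂ = solve-∀
  eq₃ : ∀ d g f → 2 * d + g + f ≡ d + g + f + d
  eq₃ = solve-∀
  eq₄ : ∀ d g f → d + g + f ≡ g + f + d
  eq₄ = solve-∀

canonical-injective : ∀ {d g f d′ g′ f′} → canonical d g f ≡ canonical d′ g′ f′ → d ≡ d′ × g ≡ g′ × f ≡ f′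
canonical-injective {d} {g} {f} {d′} {g′} {f′} e = d≡ , g≡ , f≡
  where
  nth : ∀ i → at (canonical d g f) i ≡ at (canonical d′ g′ f′) i
  nth i = cong (λ xs → at xs i) e
  f≡ : f ≡ f′
  f≡ = nth 5
  g≡ : g ≡ g′
  g≡ = +-cancelʳ-≡ f g g′ (trans (nth 4) (cong (g′ +_) (sym f≡)))
  d≡ : d ≡ d′
  d≡ = +-cancelʳ-≡ (g + f) d d′ (trans (sym (+-assoc d g f)) (trans (nth 3)
    (trans (+-assoc d′ g′ f′) (cong (d′ +_) (sym (nth 4))))))

-- Arguments are reduced modulo s and values modulo t, because a square modulo 8 is determined by
-- its root modulo 4. `G` is the quotient by t of the change in `F`.
reduce-mod : ∀ s t .{{_ : NonZero s}} .{{_ : NonZero t}} (F : ℕ → ℕ → ℕ → ℕ) (G : ℕ → ℕ → ℕ → ℕ → ℕ → ℕ → ℕ) →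
  (∀ a b c x y z → F (a + x * s) (b + y * s) (c + z * s) ≡ F a b c + G a b c x y z * t) →
  ∀ a b c → F a b c % t ≡ F (a % s) (b % s) (c % s) % t
reduce-mod s t F G e a b c = trans (cong (_% t) (trans F≡ (e (a % s) (b % s) (c % s) (a / s) (b / s) (c / s))))
  ([m+kn]%n≡m%n (F (a % s) (b % s) (c % s)) (G (a % s) (b % s) (c % s) (a / s) (b / s) (c / s)) t)
  where
  F≡ : F a b c ≡ F (a % s + a / s * s) (b % s + b / s * s) (c % s + c / s * s)
  F≡ = cong₂ (λ f c → f c) (cong₂ F (m≡m%n+[m/n]*n a s) (m≡m%n+[m/n]*n b s)) (m≡m%n+[m/n]*n c s)

canonical-mod : ∀ t .{{_ : NonZero t}} d g f →
  map (_% t) (canonical d g f) ≡ map (_% t) (canonical (d % t) (g % t) (f % t))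
canonical-mod t d g f =
  cong₂ _∷_ (linear (λ d g f → 2 * (d + g + f)) (e₁ t)) (
  cong₂ _∷_ (linear (λ d g f → 2 * d + 2 * g + f) (e₂ t)) (
  cong₂ _∷_ (linear (λ d g f → 2 * d + g + f) (e₃ t)) (
  cong₂ _∷_ (linear (λ d g f → d + g + f) (e₄ t)) (
  cong₂ _∷_ (linear (λ d g f → g + f) (e₅ t)) (
  cong (_∷ (0 % t) ∷ []) (sym (m%n%n≡m%n f t)))))))
  where
  linear : ∀ F → (∀ a b c x y z → F (a + x * t) (b + y * t) (c + z * t) ≡ F a b c + F x y z * t) →
    F d g f % t ≡ F (d % t) (g % t) (f % t) % t
  linear F e = reduce-mod t t F (λ _ _ _ → F) e d g f
  e₁ : ∀ t a b c x y z → 2 * (a + x * t + (b + y * t) + (c + z * t)) ≡ 2 * (a + b + c) + 2 * (x + y + z) * t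
  e₁ = solve-∀
  e₂ : ∀ t a b c x y z → 2 * (a + x * t) + 2 * (b + y * t) + (c + z * t) ≡ 2 * a + 2 * b + c + (2 * x + 2 * y + z) * t
  e₂ = solve-∀
  e₃ : ∀ t a b c x y z → 2 * (a + x * t) + (b + y * t) + (c + z * t) ≡ 2 * a + b + c + (2 * x + y + z) * t
  e₃ = solve-∀
  e₄ : ∀ t a b c x y z → a + x * t + (b + y * t) + (c + z * t) ≡ a + b + c + (x + y + z) * t
  e₄ = solve-∀
  e₅ : ∀ t a b c x y z → (b + y * t) + (c + z * t) ≡ b + c + (y + z) * t
  e₅ = solve-∀

triple-mod : ∀ t .{{_ : NonZero t}} b d g f →
  map (_% t) (triple b d g f) ≡ map (_% t) (triple b (d % t) (g % t) (f % t))
triple-mod t b d g f =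
  cong₂ _∷_ (linear (λ d g f → smallest b d g) (e₁ b)) (
  cong₂ _∷_ (linear (λ d g f → smallest b d g + f) (λ u v w x y z →
    trans (cong (_+ (w + z * t)) (e₁ b u v w x y z)) (e₂ t (smallest b u v) (smallest b x y) w z))) (
  cong (_∷ []) (linear (λ d g f → 2 * d + 2 * g + f) (e₃ t))))
  where
  linear : ∀ F → (∀ a b c x y z → F (a + x * t) (b + y * t) (c + z * t) ≡ F a b c + F x y z * t) →
    F d g f % t ≡ F (d % t) (g % t) (f % t) % t
  linear F e = reduce-mod t t F (λ _ _ _ → F) e d g f
  e₀ : ∀ t a b x y → 2 * (a + x * t) + (b + y * t) ≡ 2 * a + b + (2 * x + y) * t
  e₀ = solve-∀
  e₁ : ∀ β a b c x y z → smallest β (a + x * t) (b + y * t) ≡ smallest β a b + smallest β x y * t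
  e₁ true  a b c x y z = e₀ t a b x y
  e₁ false a b c x y z = refl
  e₂ : ∀ t a x c z → a + x * t + (c + z * t) ≡ a + c + (x + z) * t
  e₂ = solve-∀
  e₃ : ∀ t a b c x y z → 2 * (a + x * t) + 2 * (b + y * t) + (c + z * t) ≡ 2 * a + 2 * b + c + (2 * x + 2 * y + z) * t
  e₃ = solve-∀

norm-mod : ∀ s t .{{_ : NonZero s}} .{{_ : NonZero t}} (q : ℕ → ℕ → ℕ) →
  (∀ a x → (a + x * s) * (a + x * s) ≡ a * a + q a x * t) →
  ∀ d g f → norm d g f % t ≡ norm (d % s) (g % s) (f % s) % t
norm-mod s t q e = reduce-mod s t norm
  (λ a b c x y z → q (a + b + c) (x + y + z) + q a x + q (a + b) (x + y)) λ a b c x y z → begin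
    norm (a + x * s) (b + y * s) (c + z * s)
      ≡⟨ eq₁ a b c x y z s ⟩
    (a + b + c + (x + y + z) * s) * (a + b + c + (x + y + z) * s) + (a + x * s) * (a + x * s)
      + (a + b + (x + y) * s) * (a + b + (x + y) * s)
      ≡⟨ cong₂ _+_ (cong₂ _+_ (e (a + b + c) (x + y + z)) (e a x)) (e (a + b) (x + y)) ⟩
    (a + b + c) * (a + b + c) + q (a + b + c) (x + y + z) * t + (a * a + q a x * t)
      + ((a + b) * (a + b) + q (a + b) (x + y) * t)
      ≡⟨ eq₂ ((a + b + c) * (a + b + c)) (q (a + b + c) (x + y + z)) (a * a) (q a x) ((a + b) * (a + b)) (q (a + b) (x + y)) t ⟩
    norm a b c + (q (a + b + c) (x + y + z) + q a x + q (a + b) (x + y)) * t ∎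
  where
  open ≡-Reasoning
  eq₁ : ∀ a b c x y z s →
    (a + x * s + (b + y * s) + (c + z * s)) * (a + x * s + (b + y * s) + (c + z * s))
      + (a + x * s) * (a + x * s) + (a + x * s + (b + y * s)) * (a + x * s + (b + y * s))
    ≡ (a + b + c + (x + y + z) * s) * (a + b + c + (x + y + z) * s) + (a + x * s) * (a + x * s)
      + (a + b + (x + y) * s) * (a + b + (x + y) * s)
  eq₁ = solve-∀
  eq₂ : ∀ A p B q C r t → A + p * t + (B + q * t) + (C + r * t) ≡ A + B + C + (p + q + r) * t
  eq₂ = solve-∀

unique? : (xs : List ℕ) → Dec (Unique xs)
unique? = allPairs? (λ x y → ¬? (x ≟ y))

abstract

  -- The nonzero squares modulo 7 are 1, 2, 4, and three squares add up to 0 only as 0 + 0 + 0 or 1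
  -- + 2 + 4. In the latter case ±h, ±d, ±e are all the nonzero residues, and the seven entries are
  -- these and 0, shifted by h.
  norm-mod-7 : ∀ {a} → a < 7 → ∀ {b} → b < 7 → ∀ {c} → c < 7 → norm a b c % 7 ≡ 0 →
    (a ≡ 0 × b ≡ 0 × c ≡ 0) ⊎ Unique (map (_% 7) (canonical a b c))
  norm-mod-7 = toWitness {a? = allUpTo? (λ a → allUpTo? (λ b → allUpTo? (λ c → (norm a b c % 7 ≟ 0) →-dec
    (((a ≟ 0) ×-dec (b ≟ 0) ×-dec (c ≟ 0)) ⊎-dec unique? (map (_% 7) (canonical a b c)))) 7) 7) 7} tt

  -- The squares modulo 8 are 0, 1, 4, so the sum 5 makes one of h, d, e odd, one 2 and one 0 modulo
  -- 4. The entries are e ± d, h ± d, h + e with a common sign: one is 2 modulo 4 and the others are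
  -- the two odd residues.
  norm-mod-8 : ∀ β {a} → a < 4 → ∀ {b} → b < 4 → ∀ {c} → c < 4 → norm a b c % 8 ≡ 5 →
    Unique (map (_% 4) (0 ∷ triple β a b c))
  norm-mod-8 true = toWitness {a? = allUpTo? (λ a → allUpTo? (λ b → allUpTo? (λ c →
    (norm a b c % 8 ≟ 5) →-dec unique? (map (_% 4) (0 ∷ triple true a b c))) 4) 4) 4} tt
  norm-mod-8 false = toWitness {a? = allUpTo? (λ a → allUpTo? (λ b → allUpTo? (λ c →
    (norm a b c % 8 ≟ 5) →-dec unique? (map (_% 4) (0 ∷ triple false a b c))) 4) 4) 4} tt

open Abacus using (CompleteResidues; Thresholds; threshold; count)

triple-complete : ∀ {n} β d g f → norm d g f ≡ 56 * n + 21 → CompleteResidues 4 (0 ∷ triple β d g f)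
triple-complete {n} β d g f e = Abacus.unique⇒complete 4 {D = 0 ∷ triple β d g f}
  (subst (λ rs → Unique (0 ∷ rs)) (sym (triple-mod 4 β d g f))
    (norm-mod-8 β (m%n<n d 4) (m%n<n g 4) (m%n<n f 4)
      (trans (sym (norm-mod 4 8 (λ a x → a * x + 2 * (x * x)) eq d g f))
        (trans (cong (_% 8) (trans e (eq′ n))) ([m+kn]%n≡m%n 5 (7 * n + 2) 8)))))
  refl
  where
  eq : ∀ a x → (a + x * 4) * (a + x * 4) ≡ a * a + (a * x + 2 * (x * x)) * 8
  eq = solve-∀
  eq′ : ∀ n → 56 * n + 21 ≡ 5 + (7 * n + 2) * 8
  eq′ = solve-∀

-- Then 49 divides 56n + 21 = 7(8n + 3), so 7 divides 8n + 3, which is n + 3 modulo 7.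
multiples-of-7 : ∀ {n d g f} x y z → d ≡ x * 7 → g ≡ y * 7 → f ≡ z * 7 → norm d g f ≡ 56 * n + 21 → n % 7 ≡ 4
multiples-of-7 {n} x y z refl refl refl e =
  toWitness {a? = allUpTo? (λ r → ((r + 3) % 7 ≟ 0) →-dec (r ≟ 4)) 7} tt (m%n<n n 7)
    (trans (sym (%-distribˡ-+ n 3 7)) (trans (sym ([m+kn]%n≡m%n (n + 3) n 7))
      (trans (cong (_% 7) (trans (eq₃ n) (sym K≡))) (m*n%n≡0 (norm x y z) 7))))
  where
  eq₁ : ∀ x y z → (x * 7 + y * 7 + z * 7) * (x * 7 + y * 7 + z * 7) + x * 7 * (x * 7) + (x * 7 + y * 7) * (x * 7 + y * 7)
      ≡ 7 * (((x + y + z) * (x + y + z) + x * x + (x + y) * (x + y)) * 7)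
  eq₁ = solve-∀
  eq₂ : ∀ n → 56 * n + 21 ≡ 7 * (8 * n + 3)
  eq₂ = solve-∀
  eq₃ : ∀ n → n + 3 + n * 7 ≡ 8 * n + 3
  eq₃ = solve-∀
  K≡ : norm x y z * 7 ≡ 8 * n + 3
  K≡ = *-cancelˡ-≡ (norm x y z * 7) (8 * n + 3) 7 (trans (sym (eq₁ x y z)) (trans e (eq₂ n)))

canonical-complete : ∀ {n} d g f → n % 7 ≢ 4 → norm d g f ≡ 56 * n + 21 →
  CompleteResidues 7 (canonical d g f)
canonical-complete {n} d g f n≢4 e = complete
  (norm-mod-7 (m%n<n d 7) (m%n<n g 7) (m%n<n f 7)
    (trans (sym (norm-mod 7 7 (λ a x → 2 * a * x + x * x * 7) eq d g f))
      (trans (cong (_% 7) (trans e (eq′ n))) (m*n%n≡0 (8 * n + 3) 7))))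
  where
  eq : ∀ a x → (a + x * 7) * (a + x * 7) ≡ a * a + (2 * a * x + x * x * 7) * 7
  eq = solve-∀
  eq′ : ∀ n → 56 * n + 21 ≡ (8 * n + 3) * 7
  eq′ = solve-∀
  multiple : ∀ a → a % 7 ≡ 0 → a ≡ a / 7 * 7
  multiple a p = trans (m≡m%n+[m/n]*n a 7) (cong (_+ a / 7 * 7) p)
  complete : (d % 7 ≡ 0 × g % 7 ≡ 0 × f % 7 ≡ 0) ⊎ Unique (map (_% 7) (canonical (d % 7) (g % 7) (f % 7))) →
    CompleteResidues 7 (canonical d g f)
  complete (inj₂ u) = Abacus.unique⇒complete 7 {D = canonical d g f} (subst Unique (sym (canonical-mod 7 d g f)) u) refl
  complete (inj₁ (d0 , g0 , f0)) = contradiction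
    (multiples-of-7 {n} (d / 7) (g / 7) (f / 7) (multiple d d0) (multiple g g0) (multiple f f0) e) n≢4

-- For d = 0 the entries h + d and h would coincide.
canonical-positive : ∀ d g f → CompleteResidues 7 (canonical d g f) → 0 < d
canonical-positive zero g f c
  with _ ∷ _ ∷ (p ∷ _) ∷ _ ← Abacus.complete-unique 7 {D = canonical 0 g f} c = contradiction refl p
canonical-positive (suc d) g f c = z<s

-- The size of a core in terms of the norm

triple-squares : ∀ β d g f → let S = sum (0 ∷ triple β d g f) in
  4 * squares (0 ∷ triple β d g f) ≡ S * S + 4 * norm d g f
triple-squares true d g f = eq d g f
  where
  eq : ∀ d g f →
    4 * ((2 * d + g) * (2 * d + g) + ((2 * d + g + f) * (2 * d + g + f) + ((2 * d + 2 * g + f) * (2 * d + 2 * g + f) + 0)))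
    ≡ ((2 * d + g) + ((2 * d + g + f) + ((2 * d + 2 * g + f) + 0))) * ((2 * d + g) + ((2 * d + g + f) + ((2 * d + 2 * g + f) + 0)))
      + 4 * ((d + g + f) * (d + g + f) + d * d + (d + g) * (d + g))
  eq = solve-∀
triple-squares false d g f = eq d g f
  where
  eq : ∀ d g f →
    4 * (g * g + ((g + f) * (g + f) + ((2 * d + 2 * g + f) * (2 * d + 2 * g + f) + 0)))
    ≡ (g + ((g + f) + ((2 * d + 2 * g + f) + 0))) * (g + ((g + f) + ((2 * d + 2 * g + f) + 0)))
      + 4 * ((d + g + f) * (d + g + f) + d * d + (d + g) * (d + g))
  eq = solve-∀

-- Let S and Q be the sum of the thresholds and of their squares. Once the number of parts is
-- eliminated, the terms linear in S cancel, and the size depends only on tQ - S², which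
-- `triple-squares` evaluates for t = 4.
core-size-4 : ∀ {λ′} β d g f → IsPartition λ′ → Closed 4 (beta λ′) → CompleteResidues 4 (0 ∷ triple β d g f) →
  Thresholds 4 (beta λ′) (0 ∷ triple β d g f) → 8 * size λ′ + 5 ≡ norm d g f
core-size-4 {λ′} β d g f part closed complete thr =
  let S≡ , e = Abacus.core-size 4 part closed complete thr
  in solve-size (size λ′) (4 * length λ′) (sum (0 ∷ triple β d g f)) (squares (0 ∷ triple β d g f)) (norm d g f)
       S≡ e (triple-squares β d g f)
  where
  eq₁ : ∀ n u → (u + 6) * (u + 6) + 4 * (8 * n + 5) + (96 + 4 * u) ≡ 2 * (4 * 4) * n + u * u + 4 * 4 * (u + 6) + 4 * 14
  eq₁ = solve-∀
  eq₂ : ∀ Q u → 4 * Q + 4 * 4 * 6 + 4 * u ≡ 4 * Q + (96 + 4 * u)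
  eq₂ = solve-∀
  -- 6 and 14 are the sum and the sum of squares of the residues 0, 1, 2, 3.
  solve-size : ∀ n u S Q N → S ≡ u + 6 →
    2 * (4 * 4) * n + u * u + 4 * 4 * S + 4 * 14 ≡ 4 * Q + 4 * 4 * 6 + 4 * u →
    4 * Q ≡ S * S + 4 * N → 8 * n + 5 ≡ N
  solve-size n u S Q N refl e q = *-cancelˡ-≡ (8 * n + 5) N 4 (+-cancelˡ-≡ ((u + 6) * (u + 6)) (4 * (8 * n + 5)) (4 * N)
    (trans (+-cancelʳ-≡ (96 + 4 * u) ((u + 6) * (u + 6) + 4 * (8 * n + 5)) (4 * Q) (trans (eq₁ n u) (trans e (eq₂ Q u)))) q))

canonical-squares : ∀ d g f → let S = sum (canonical d g f) in
  7 * squares (canonical d g f) ≡ S * S + 14 * norm d g f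
canonical-squares d g f = eq d g f
  where
  eq : ∀ d g f →
    7 * (2 * (d + g + f) * (2 * (d + g + f)) + ((2 * d + 2 * g + f) * (2 * d + 2 * g + f) + ((2 * d + g + f) * (2 * d + g + f)
      + ((d + g + f) * (d + g + f) + ((g + f) * (g + f) + (f * f + (0 * 0 + 0)))))))
    ≡ (2 * (d + g + f) + ((2 * d + 2 * g + f) + ((2 * d + g + f) + ((d + g + f) + ((g + f) + (f + (0 + 0)))))))
      * (2 * (d + g + f) + ((2 * d + 2 * g + f) + ((2 * d + g + f) + ((d + g + f) + ((g + f) + (f + (0 + 0)))))))
      + 14 * ((d + g + f) * (d + g + f) + d * d + (d + g) * (d + g))
  eq = solve-∀

core-size-7 : ∀ {μ} d g f → IsPartition μ → Closed 7 (beta μ) → CompleteResidues 7 (canonical d g f) →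
  Thresholds 7 (beta μ) (canonical d g f) → 7 * size μ + 14 ≡ norm d g f
core-size-7 {μ} d g f part closed complete thr =
  let S≡ , e = Abacus.core-size 7 part closed complete thr
  in solve-size (size μ) (7 * length μ) (sum (canonical d g f)) (squares (canonical d g f)) (norm d g f)
       S≡ e (canonical-squares d g f)
  where
  eq₁ : ∀ n u → (u + 21) * (u + 21) + 14 * (7 * n + 14) + (1029 + 7 * u)
      ≡ 2 * (7 * 7) * n + u * u + 7 * 7 * (u + 21) + 7 * 91
  eq₁ = solve-∀
  eq₂ : ∀ Q u → 7 * Q + 7 * 7 * 21 + 7 * u ≡ 7 * Q + (1029 + 7 * u)
  eq₂ = solve-∀
  solve-size : ∀ n u S Q N → S ≡ u + 21 →
    2 * (7 * 7) * n + u * u + 7 * 7 * S + 7 * 91 ≡ 7 * Q + 7 * 7 * 21 + 7 * u →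
    7 * Q ≡ S * S + 14 * N → 7 * n + 14 ≡ N
  solve-size n u S Q N refl e q = *-cancelˡ-≡ (7 * n + 14) N 14 (+-cancelˡ-≡ ((u + 21) * (u + 21)) (14 * (7 * n + 14)) (14 * N)
    (trans (+-cancelʳ-≡ (1029 + 7 * u) ((u + 21) * (u + 21) + 14 * (7 * n + 14)) (7 * Q) (trans (eq₁ n u) (trans e (eq₂ Q u)))) q))

-- Sorting and parametrizing three thresholds

≤ᵇ-true : ∀ {x y} → (x ≤ᵇ y) ≡ true → x ≢ y → x < y
≤ᵇ-true e = ≤∧≢⇒< (≤ᵇ⇒≤ _ _ (subst T (sym e) tt))

≤ᵇ-false : ∀ {x y} → (x ≤ᵇ y) ≡ false → y < x
≤ᵇ-false e = ≰⇒> λ p → subst T e (≤⇒≤ᵇ p)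

sort3-sorted : ∀ {a b c} → a ≢ b → a ≢ c → b ≢ c → ∃ λ x → ∃₂ λ y z →
  sort3 a b c ≡ (x , y , z) × x < y × y < z × x ∷ y ∷ z ∷ [] ↭ a ∷ b ∷ c ∷ []
sort3-sorted {a} {b} {c} a≢b a≢c b≢c with a ≤ᵇ b in ab | b ≤ᵇ c in bc | a ≤ᵇ c in ac
... | true  | true  | _     = a , b , c , refl , ≤ᵇ-true ab a≢b , ≤ᵇ-true bc b≢c , ↭-refl
... | true  | false | true  = a , c , b , refl , ≤ᵇ-true ac a≢c , ≤ᵇ-false bc , prep a (swap c b ↭-refl)
... | true  | false | false = c , a , b , refl , ≤ᵇ-false ac , ≤ᵇ-true ab a≢b ,
  ↭-trans (swap c a ↭-refl) (prep a (swap c b ↭-refl))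
... | false | _     | true  = b , a , c , refl , ≤ᵇ-false ab , ≤ᵇ-true ac a≢c , swap b a ↭-refl
... | false | true  | false = b , c , a , refl , ≤ᵇ-true bc b≢c , ≤ᵇ-false ac ,
  ↭-trans (prep b (swap c a ↭-refl)) (swap b a ↭-refl)
... | false | false | false = c , b , a , refl , ≤ᵇ-false bc , ≤ᵇ-false ab ,
  ↭-trans (prep c (swap b a ↭-refl)) (↭-trans (swap c a ↭-refl) (prep a (swap c b ↭-refl)))

-- The total 4l + 6 is even, so the difference of z and x + y is even as well. It is 2d, and its
-- sign decides β; a zero difference goes to `true`.
shape : ∀ {x y z l} → 0 < x → x < y → y < z → x + y + z ≡ 4 * l + 6 → ∃₂ λ β d → ∃₂ λ g f →
  0 < g × 0 < f × x ≡ smallest β d g × y ≡ smallest β d g + f × z ≡ 2 * d + 2 * g + f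
shape {x} {y} {z} {l} 0<x x<y y<z e with <-≤-connex (x + y) z
... | inj₂ z≤x+y = true , d , g , f , m<n⇒0<n∸m y<z , m<n⇒0<n∸m x<y , x≡ , y≡ , z≡
  where
  g = z ∸ y
  f = y ∸ x
  k = x + y ∸ z
  k-even : 2 ∣ k
  k-even = ∣m+n∣m⇒∣n {m = z * 2} (divides (2 * l + 3) (trans (cong₂ _+_ (*-comm z 2) refl)
    (trans (eq₁ z k) (trans (cong (_+ z) (m+[n∸m]≡n z≤x+y)) (trans e (eq₂ l)))))) (divides-refl z)
    where
    eq₁ : ∀ z k → 2 * z + k ≡ z + k + z
    eq₁ = solve-∀
    eq₂ : ∀ l → 4 * l + 6 ≡ (2 * l + 3) * 2
    eq₂ = solve-∀
  d = _∣_.quotient k-even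
  k≡ : k ≡ 2 * d
  k≡ = trans (_∣_.equality k-even) (*-comm d 2)
  y+g : y + g ≡ z
  y+g = m+[n∸m]≡n (<⇒≤ y<z)
  x≡ : x ≡ 2 * d + g
  x≡ = +-cancelʳ-≡ y _ _ (trans (sym (m+[n∸m]≡n z≤x+y)) (trans (cong₂ _+_ (sym y+g) k≡) (eq y g (2 * d))))
    where
    eq : ∀ y g k → y + g + k ≡ k + g + y
    eq = solve-∀
  y≡ : y ≡ 2 * d + g + f
  y≡ = trans (sym (m+[n∸m]≡n (<⇒≤ x<y))) (cong (_+ f) x≡)
  z≡ : z ≡ 2 * d + 2 * g + f
  z≡ = trans (sym y+g) (trans (cong (_+ g) y≡) (eq d g f))
    where
    eq : ∀ d g f → 2 * d + g + f + g ≡ 2 * d + 2 * g + f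
    eq = solve-∀
... | inj₁ x+y<z = false , d , x , f , 0<x , m<n⇒0<n∸m x<y , refl , sym y≡ , z≡
  where
  f = y ∸ x
  k = z ∸ (x + y)
  z≡k : x + y + k ≡ z
  z≡k = m+[n∸m]≡n (<⇒≤ x+y<z)
  k-even : 2 ∣ k
  k-even = ∣m+n∣m⇒∣n {m = (x + y) * 2} (divides (2 * l + 3)
    (trans (eq₁ (x + y) k) (trans (cong (x + y +_) z≡k) (trans e (eq₂ l))))) (divides-refl (x + y))
    where
    eq₁ : ∀ s k → s * 2 + k ≡ s + (s + k)
    eq₁ = solve-∀
    eq₂ : ∀ l → 4 * l + 6 ≡ (2 * l + 3) * 2
    eq₂ = solve-∀
  d = _∣_.quotient k-even
  k≡ : k ≡ 2 * d
  k≡ = trans (_∣_.equality k-even) (*-comm d 2)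
  y≡ : x + f ≡ y
  y≡ = m+[n∸m]≡n (<⇒≤ x<y)
  z≡ : z ≡ 2 * d + 2 * x + f
  z≡ = trans (sym z≡k) (trans (cong₂ (λ y k → x + y + k) (sym y≡) k≡) (eq x f d))
    where
    eq : ∀ x f d → x + (x + f) + 2 * d ≡ 2 * d + 2 * x + f
    eq = solve-∀

-- Cores determined by their thresholds

module Cores (t : ℕ) .{{_ : NonZero t}} where

  open Abacus t hiding (CompleteResidues; Thresholds; threshold; count; runner)

  module _ {λ′ : Partition} (part : IsPartition λ′) where

    beta-partition-decreasing : Decreasing (beta λ′)
    beta-partition-decreasing = beta-decreasing (weaklyDecreasing part)

    core-closed : IsCore t λ′ → Closed t (beta λ′)
    core-closed = core⇒closed (>-nonZero⁻¹ t) part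

    threshold-zero : IsCore t λ′ → threshold t (beta λ′) 0 ≡ 0
    threshold-zero core = n≤0⇒n≡0 (≮⇒≥ λ p → <-irrefl refl (All.lookup (beta-positive (proj₂ part))
      (<threshold⇒∈ beta-partition-decreasing (core-closed core)
        (subst (λ r → 0 < threshold t (beta λ′) r) (sym (m<n⇒m%n≡m (>-nonZero⁻¹ t))) p))))

  abstract
    core-with-thresholds : ∀ {D} → CompleteResidues t D → 0 ∈ D →
      ∃ λ λ′ → IsPartition λ′ × IsCore t λ′ × Thresholds t (beta λ′) D
    core-with-thresholds {D} complete 0∈D =
      let S , d , pos , closed , thr = beta-with-thresholds complete 0∈D
          b≡ = beta-unbeta d pos
      in unbeta S , unbeta-partition d pos
       , closed⇒core (unbeta-partition d pos) (subst (Closed t) (sym b≡) closed)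
       , subst (λ S → Thresholds t S D) (sym b≡) thr

  core-unique : ∀ {λ′ μ D} → IsPartition λ′ → IsCore t λ′ → IsPartition μ → IsCore t μ → CompleteResidues t D →
    Thresholds t (beta λ′) D → Thresholds t (beta μ) D → λ′ ≡ μ
  core-unique {λ′} {μ} {D} part core part′ core′ complete thr thr′ = beta-injective (threshold-injective
    (beta-partition-decreasing part) (core-closed part core) (beta-partition-decreasing part′) (core-closed part′ core′)
    λ r<t → let x , x∈ , e = complete-∈ {D} complete r<t in
      trans (cong (threshold t (beta λ′)) e) (trans (All.lookup thr x∈)
        (sym (trans (cong (threshold t (beta μ)) e) (All.lookup thr′ x∈)))))

  abacus-count : ∀ λ′ → abacus t λ′ ≡ V.tabulate (λ c → count t (toℕ c) (beta λ′))
  abacus-count λ′ = cong (λ S → V.tabulate (λ c → count t (toℕ c) S)) (structureNumbers≡beta λ′)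

  -- The origin of the floors in φ: dividing a threshold by t returns the abacus entry of its class.
  threshold-/ : ∀ S {r} → r < t → threshold t S r / t ≡ count t r S
  threshold-/ S {r} r<t = *-cancelʳ-≡ _ _ t (+-cancelˡ-≡ r _ _ (begin
    r + threshold t S r / t * t                     ≡⟨ cong (_+ threshold t S r / t * t) (residue (count t r S) r<t) ⟨
    threshold t S r % t + threshold t S r / t * t   ≡⟨ m≡m%n+[m/n]*n (threshold t S r) t ⟨
    count t r S * t + r                             ≡⟨ +-comm _ r ⟩
    r + count t r S * t                             ∎))
    where open ≡-Reasoning

-- 4-cores

tripleTuple : Bool → ℕ → ℕ → ℕ → ℕ × ℕ × ℕ
tripleTuple β d g f = smallest β d g , smallest β d g + f , 2 * d + 2 * g + f

sortedB-threshold : ∀ λ′ → let b = threshold 4 (beta λ′) in sortedB λ′ ≡ sort3 (b 1) (b 2) (b 3)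
sortedB-threshold λ′ = trans
  (cong (λ S → sort3 (4 * count 4 1 S + 1) (4 * count 4 2 S + 2) (4 * count 4 3 S + 3)) (structureNumbers≡beta λ′))
  (cong₂ (λ f z → f z)
    (cong₂ sort3 (cong (_+ 1) (*-comm 4 (count 4 1 S))) (cong (_+ 2) (*-comm 4 (count 4 2 S))))
    (cong (_+ 3) (*-comm 4 (count 4 3 S))))
  where S = beta λ′

-- `d` may be 0 here, as it is for the empty partition; positivity is recovered from the residues
-- modulo 7.
record TripleOf (λ′ : Partition) : Set where
  constructor triple-of
  field
    {β}        : Bool
    {d g f}    : ℕ
    g-positive : 0 < g
    f-positive : 0 < f
    sorted     : sortedB λ′ ≡ tripleTuple β d g f
    complete   : CompleteResidues 4 (0 ∷ triple β d g f)
    thresholds : Thresholds 4 (beta λ′) (0 ∷ triple β d g f)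

4-core-triple : ∀ {λ′} → IsPartition λ′ → IsCore 4 λ′ → TripleOf λ′
4-core-triple {λ′} part core =
  let x , y , z , s , x<y , y<z , σ = sort3-sorted (distinct (λ ())) (distinct (λ ())) (distinct (λ ()))
      complete = ↭-trans (Perm.map⁺ (_% 4) (prep 0 σ)) (↭-reflexive residues)
      thr = All-resp-↭ (prep 0 (↭-sym σ)) thresholds
      S≡ , _ = Abacus.core-size 4 {D = 0 ∷ x ∷ y ∷ z ∷ []} part closed complete thr
      β , d , g , f , 0<g , 0<f , x≡ , y≡ , z≡ =
        -- The residue 0 is already taken by the threshold 0, so the smallest of the other three is
        -- positive.
        shape {l = length λ′} (nonzero (λ e → All.head (head-unique {x} {y} {z} complete) (cong (_% 4) (sym e))))
          x<y y<z (trans (eq x y z) S≡)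
  in triple-of {β = β} {d} {g} {f} 0<g 0<f
   (trans (sortedB-threshold λ′) (trans s (cong₂ _,_ x≡ (cong₂ _,_ y≡ z≡))))
   (subst (λ D → CompleteResidues 4 (0 ∷ D)) (cong₂ _∷_ x≡ (cong₂ _∷_ y≡ (cong (_∷ []) z≡))) complete)
   (subst (λ D → Thresholds 4 (beta λ′) (0 ∷ D)) (cong₂ _∷_ x≡ (cong₂ _∷_ y≡ (cong (_∷ []) z≡))) thr)
  where
  open Cores 4
  closed = core-closed part core
  b = threshold 4 (beta λ′)
  b%4 : ∀ {r} → r < 4 → b r % 4 ≡ r
  b%4 = Abacus.threshold-residue 4 (beta-partition-decreasing part) closed
  distinct : ∀ {i j} {p : True (i <? 4)} {q : True (j <? 4)} → i ≢ j → b i ≢ b j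
  distinct {p = p} {q} i≢j e = i≢j (trans (sym (b%4 (toWitness p))) (trans (cong (_% 4) e) (b%4 (toWitness q))))
  nonzero : ∀ {n} → n ≢ 0 → 0 < n
  nonzero = n≢0⇒n>0
  residues : 0 ∷ b 1 % 4 ∷ b 2 % 4 ∷ b 3 % 4 ∷ [] ≡ upTo 4
  residues = cong (0 ∷_) (cong₂ _∷_ (b%4 (toWitness {a? = 1 <? 4} tt)) (cong₂ _∷_ (b%4 (toWitness {a? = 2 <? 4} tt))
    (cong (_∷ []) (b%4 (toWitness {a? = 3 <? 4} tt)))))
  thresholds : Thresholds 4 (beta λ′) (0 ∷ b 1 ∷ b 2 ∷ b 3 ∷ [])
  thresholds = threshold-zero part core ∷ cong b (b%4 (toWitness {a? = 1 <? 4} tt))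
    ∷ cong b (b%4 (toWitness {a? = 2 <? 4} tt)) ∷ cong b (b%4 (toWitness {a? = 3 <? 4} tt)) ∷ []
  head-unique : ∀ {x y z} → CompleteResidues 4 (0 ∷ x ∷ y ∷ z ∷ []) → All (0 ≢_) (x % 4 ∷ y % 4 ∷ z % 4 ∷ [])
  head-unique {x} {y} {z} c = AllPairs.head (Abacus.complete-unique 4 {D = 0 ∷ x ∷ y ∷ z ∷ []} c)
  eq : ∀ x y z → x + y + z ≡ x + (y + (z + 0))
  eq = solve-∀

triple-increasing : ∀ β d {g f} → 0 < g → 0 < f → Decreasing (reverse (0 ∷ triple β d g f))
triple-increasing β d {g} {f} 0<g 0<f = Linked⇒AllPairs (λ p q → <-trans q p)
  (largest β ∷ m<m+n _ 0<f ∷ positive β ∷ [-])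
  where
  positive : ∀ β → 0 < smallest β d g
  positive true  = <-≤-trans 0<g (m≤n+m g (2 * d))
  positive false = 0<g
  eq₁ : ∀ d g f → 2 * d + 2 * g + f ≡ 2 * d + g + f + g
  eq₁ = solve-∀
  eq₂ : ∀ d g f → 2 * d + 2 * g + f ≡ g + f + (g + 2 * d)
  eq₂ = solve-∀
  largest : ∀ β → smallest β d g + f < 2 * d + 2 * g + f
  largest true  = subst (2 * d + g + f <_) (sym (eq₁ d g f)) (m<m+n _ 0<g)
  largest false = subst (g + f <_) (sym (eq₂ d g f)) (m<m+n _ (<-≤-trans 0<g (m≤m+n g (2 * d))))

-- Both triples list the nonzero thresholds in increasing order. Hence a triple prescribed in the
-- construction of a core is what `sortedB` returns for it.
triple-unique : ∀ {λ′ β d g f} (τ : TripleOf λ′) → 0 < g → 0 < f → CompleteResidues 4 (0 ∷ triple β d g f) →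
  Thresholds 4 (beta λ′) (0 ∷ triple β d g f) → sortedB λ′ ≡ tripleTuple β d g f
triple-unique {λ′} {β} {d} {g} {f} (triple-of {β′} {d′} {g′} {f′} 0<g′ 0<f′ s complete′ thr′) 0<g 0<f complete thr =
  trans s (cong (λ xs → at xs 2 , at xs 1 , at xs 0)
    (decreasing-≡ (triple-increasing β′ d′ 0<g′ 0<f′) (triple-increasing β d 0<g 0<f)
      (λ p → ∈-resp-↭ (↭-sym (Perm.↭-reverse (0 ∷ triple β d g f)))
        (Abacus.thresholds-⊆ 4 {S = beta λ′} {D = 0 ∷ triple β′ d′ g′ f′} {D′ = 0 ∷ triple β d g f} thr′ thr complete
          (∈-resp-↭ (Perm.↭-reverse (0 ∷ triple β′ d′ g′ f′)) p)))
      (λ p → ∈-resp-↭ (↭-sym (Perm.↭-reverse (0 ∷ triple β′ d′ g′ f′)))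
        (Abacus.thresholds-⊆ 4 {S = beta λ′} {D = 0 ∷ triple β d g f} {D′ = 0 ∷ triple β′ d′ g′ f′} thr thr′ complete′
          (∈-resp-↭ (Perm.↭-reverse (0 ∷ triple β d g f)) p)))))

record CoreWithTriple (n : ℕ) (β : Bool) (d g f : ℕ) : Set where
  constructor core-with-triple
  field
    {partition} : Partition
    core        : InC 4 (7 * n + 2) partition
    sorted      : sortedB partition ≡ tripleTuple β d g f
    thresholds  : Thresholds 4 (beta partition) (0 ∷ triple β d g f)

-- Only the thresholds are prescribed; the size 7n + 2 is then forced by the norm.
4-core-with-triple : ∀ {n} β d {g f} → 0 < g → 0 < f → norm d g f ≡ 56 * n + 21 → CoreWithTriple n β d g f
4-core-with-triple {n} β d {g} {f} 0<g 0<f N =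
  from-core (core-with-thresholds {0 ∷ triple β d g f} complete (here refl))
  where
  open Cores 4
  complete = triple-complete {n} β d g f N
  eq : ∀ n → 56 * n + 21 ≡ 8 * (7 * n + 2) + 5
  eq = solve-∀
  size≡ : ∀ {m} → 8 * m + 5 ≡ norm d g f → m ≡ 7 * n + 2
  size≡ {m} e = *-cancelˡ-≡ m (7 * n + 2) 8 (+-cancelʳ-≡ 5 (8 * m) (8 * (7 * n + 2)) (trans e (trans N (eq n))))
  from-core : (∃ λ λ′ → IsPartition λ′ × IsCore 4 λ′ × Thresholds 4 (beta λ′) (0 ∷ triple β d g f)) → CoreWithTriple n β d g f
  from-core (λ′ , part , core , thr) = core-with-triple
    (part , core , size≡ (core-size-4 β d g f part (core-closed part core) complete thr))
    (triple-unique {β = β} {d} (4-core-triple part core) 0<g 0<f complete thr) thr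

-- Self-conjugate 7-cores

canonical-reflect : ∀ d g f {c} → c ∈ canonical d g f → ∃ λ c′ → c′ ∈ canonical d g f × c + c′ ≡ 2 * (d + g + f)
canonical-reflect d g f = λ where
    (here refl)                                         → 0 , there (there (there (there (there (there (here refl)))))) , +-identityʳ _
    (there (here refl))                                 → f , there (there (there (there (there (here refl))))) , eq₁ d g f
    (there (there (here refl)))                         → g + f , there (there (there (there (here refl)))) , eq₂ d g f
    (there (there (there (here refl))))                 → d + g + f , there (there (there (here refl))) , eq₃ d g f
    (there (there (there (there (here refl)))))         → 2 * d + g + f , there (there (here refl)) , eq₄ d g f
    (there (there (there (there (there (here refl)))))) → 2 * d + 2 * g + f , there (here refl) , eq₅ d g f
    (there (there (there (there (there (there (here refl))))))) → 2 * (d + g + f) , here refl , refl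
  where
  eq₁ : ∀ d g f → 2 * d + 2 * g + f + f ≡ 2 * (d + g + f)
  eq₁ = solve-∀
  eq₂ : ∀ d g f → 2 * d + g + f + (g + f) ≡ 2 * (d + g + f)
  eq₂ = solve-∀
  eq₃ : ∀ d g f → d + g + f + (d + g + f) ≡ 2 * (d + g + f)
  eq₃ = solve-∀
  eq₄ : ∀ d g f → g + f + (2 * d + g + f) ≡ 2 * (d + g + f)
  eq₄ = solve-∀
  eq₅ : ∀ d g f → f + (2 * d + 2 * g + f) ≡ 2 * (d + g + f)
  eq₅ = solve-∀

-- If h ≤ 3 then d ≤ e ≤ 2, and the norm is at most 9 + 4 + 4 = 17 < 21. The bound gives 2h ≥ 7, so
-- that 2h - 7 can be the largest beta number.
norm-small : ∀ {n d g f} → 0 < f → norm d g f ≡ 56 * n + 21 → 4 ≤ d + g + f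
norm-small {n} {d} {g} {f} 0<f N = ≮⇒≥ λ p →
  let h≤3 = ≤-pred p
      e≤2 : d + g ≤ 2
      e≤2 = ≤-pred (≤-trans (m<m+n (d + g) 0<f) h≤3)
      d≤2 = ≤-trans (m≤m+n d g) e≤2
  in <⇒≱ (toWitness {a? = 17 <? 21} tt) (begin
    21          ≤⟨ m≤n+m 21 (56 * n) ⟩
    56 * n + 21 ≡⟨ N ⟨
    norm d g f  ≤⟨ +-mono-≤ (+-mono-≤ (*-mono-≤ h≤3 h≤3) (*-mono-≤ d≤2 d≤2)) (*-mono-≤ e≤2 e≤2) ⟩
    17          ∎)
  where open ≤-Reasoning

max-bound : ∀ {λ′ M x} → WeaklyDecreasing λ′ → suc M ≡ at λ′ 0 + length λ′ → x ∈ beta λ′ → x ≤ M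
max-bound {x = x} w e p = ≤-pred (subst (suc x ≤_) (sym e) (beta<max w p))

∈-beta⇒nonempty : ∀ {λ′ x} → x ∈ beta λ′ → 0 < length λ′
∈-beta⇒nonempty {_ ∷ _} _ = z<s

canonical-selfConjugate : ∀ {μ d g f} → IsPartition μ → IsCore 7 μ → CompleteResidues 7 (canonical d g f) →
  Thresholds 7 (beta μ) (canonical d g f) → 4 ≤ d + g + f → SelfConjugate μ
canonical-selfConjugate {μ} {d} {g} {f} part core complete thr 4≤h =
  symmetric⇒selfConjugate part M≡ (Reflection.reflect-symmetric 7 {D = canonical d g f} dec closed complete thr (canonical-reflect d g f) M+7)
  where
  A = 2 * (d + g + f)
  dec = beta-decreasing (weaklyDecreasing part)
  closed = Cores.core-closed 7 part core
  7≤A : 7 ≤ A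
  7≤A = ≤-trans (toWitness {a? = 7 ≤? 8} tt) (*-monoʳ-≤ 2 4≤h)
  A∸7∈ : A ∸ 7 ∈ beta μ
  A∸7∈ = Abacus.<threshold⇒∈ 7 dec closed (subst (A ∸ 7 <_) (sym thr-A)
    (∸-monoʳ-< {o = 0} z<s 7≤A))
    where
    thr-A : threshold 7 (beta μ) ((A ∸ 7) % 7) ≡ A
    thr-A = trans (cong (threshold 7 (beta μ)) (trans (sym ([m+n]%n≡m%n (A ∸ 7) 7)) (cong (_% 7) (m∸n+n≡m 7≤A))))
      (All.head thr)
  nonempty = ∈-beta⇒nonempty {μ} A∸7∈
  M = at μ 0 + length μ ∸ 1
  M≡ : suc M ≡ at μ 0 + length μ
  M≡ = m+[n∸m]≡n {1} (≤-trans nonempty (m≤n+m (length μ) (at μ 0)))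
  bounded : ∀ {c} → c ∈ canonical d g f → c ≤ A
  bounded {c} c∈ = let c′ , _ , e = canonical-reflect d g f c∈ in subst (c ≤_) e (m≤m+n c c′)
  M+7≤A : M + 7 ≤ A
  M+7≤A =
    -- The threshold of the class of M exceeds M, hence is at least M + 7, and no threshold exceeds
    -- A.
    let c , c∈ , M%7 = Abacus.complete-∈ 7 {D = canonical d g f} complete (m%n<n M 7)
        M<c = subst (M <_) (trans (cong (threshold 7 (beta μ)) M%7) (All.lookup thr c∈))
                (Abacus.∈⇒<threshold 7 dec closed (max-∈-beta {μ} nonempty M≡))
        k , e = Reflection.congruent-< 7 M<c M%7
    in ≤-trans (+-monoʳ-≤ M (m≤m+n 7 (k * 7))) (≤-trans (≤-reflexive (sym e)) (bounded c∈))
  M+7 : M + 7 ≡ A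
  M+7 = ≤-antisym M+7≤A (subst (_≤ M + 7) (m∸n+n≡m 7≤A) (+-monoˡ-≤ 7 (max-bound (weaklyDecreasing part) M≡ A∸7∈)))

7-core-with-thresholds : ∀ {n d g f} → 0 < f → norm d g f ≡ 56 * n + 21 → CompleteResidues 7 (canonical d g f) →
  ∃ λ μ → InSC 7 (8 * n + 1) μ × Thresholds 7 (beta μ) (canonical d g f)
7-core-with-thresholds {n} {d} {g} {f} 0<f N complete =
  from-core (Cores.core-with-thresholds 7 {canonical d g f} complete
    (there (there (there (there (there (there (here refl))))))))
  where
  eq : ∀ n → 56 * n + 21 ≡ 7 * (8 * n + 1) + 14
  eq = solve-∀
  size≡ : ∀ {m} → 7 * m + 14 ≡ norm d g f → m ≡ 8 * n + 1
  size≡ {m} e = *-cancelˡ-≡ m (8 * n + 1) 7 (+-cancelʳ-≡ 14 (7 * m) (7 * (8 * n + 1)) (trans e (trans N (eq n))))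
  from-core : (∃ λ μ → IsPartition μ × IsCore 7 μ × Thresholds 7 (beta μ) (canonical d g f)) →
    ∃ λ μ → InSC 7 (8 * n + 1) μ × Thresholds 7 (beta μ) (canonical d g f)
  from-core (μ , part , core , thr) =
    μ , ((part , core , size≡ (core-size-7 d g f part (Cores.core-closed 7 part core) complete thr))
      , canonical-selfConjugate {μ} {d} {g} {f} part core complete thr (norm-small {n} {d} {g} {f} 0<f N)) , thr

HasShape : List ℕ → Set
HasShape S = ∃ λ d → ∃₂ λ g f → 0 < d × 0 < g × 0 < f × Thresholds 7 S (canonical d g f)

module _ {S : List ℕ} {h : ℕ} (thr-0 : threshold 7 S 0 ≡ 0)
         (thr-h : threshold 7 S (h % 7) ≡ h) (thr-A : threshold 7 S ((2 * h) % 7) ≡ 2 * h) where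

  private
    Quadruple : List ℕ → Set
    Quadruple L = Thresholds 7 S L × Unique L × All (0 <_) L

    quadruple-↭ : ∀ {L L′} → L ↭ L′ → Quadruple L → Quadruple L′
    quadruple-↭ σ (a , u , p) = All-resp-↭ σ a , unique-↭ σ u , All-resp-↭ σ p

    -- Both pairs have mean h, so s < q < h < p < r, and the four entries are h - e, h - d, h + d, h
    -- + e. The lemmas that follow reach this order by swapping within and between the pairs.
    ordered : ∀ {p q r s} → Quadruple (p ∷ q ∷ r ∷ s ∷ []) → p + q ≡ 2 * h → r + s ≡ 2 * h →
      q < p → s < r → p < r → HasShape S
    ordered {p} {q} {r} {s} ((tp ∷ tq ∷ tr ∷ ts ∷ []) , _ , (_ ∷ _ ∷ _ ∷ 0<s ∷ [])) p+q r+s q<p s<r p<r =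
      h ∸ q , q ∸ s , s , m<n⇒0<n∸m q<h , m<n⇒0<n∸m s<q , 0<s ,
      subst (λ x → threshold 7 S (x % 7) ≡ x) (cong (2 *_) (sym h≡)) thr-A
      ∷ subst (λ x → threshold 7 S (x % 7) ≡ x) (sym r≡) tr
      ∷ subst (λ x → threshold 7 S (x % 7) ≡ x) (sym p≡) tp
      ∷ subst (λ x → threshold 7 S (x % 7) ≡ x) (sym h≡) thr-h
      ∷ subst (λ x → threshold 7 S (x % 7) ≡ x) (sym q≡) tq ∷ ts ∷ thr-0 ∷ []
      where
      s<q : s < q
      s<q = ≰⇒> λ q≤s → <-irrefl (trans p+q (sym r+s)) (+-mono-<-≤ p<r q≤s)
      q<h : q < h
      q<h = *-cancelˡ-< 2 q h (subst₂ _<_ (cong (q +_) (sym (+-identityʳ q))) (trans (+-comm q p) p+q) (+-monoʳ-< q q<p))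
      q≡ : q ∸ s + s ≡ q
      q≡ = m∸n+n≡m (<⇒≤ s<q)
      h≡ : h ∸ q + (q ∸ s) + s ≡ h
      h≡ = trans (+-assoc (h ∸ q) (q ∸ s) s) (trans (cong (h ∸ q +_) q≡) (m∸n+n≡m (<⇒≤ q<h)))
      eq₁ : ∀ d g f → 2 * d + g + f + (g + f) ≡ 2 * (d + g + f)
      eq₁ = solve-∀
      eq₂ : ∀ d g f → 2 * d + 2 * g + f + f ≡ 2 * (d + g + f)
      eq₂ = solve-∀
      p≡ : 2 * (h ∸ q) + (q ∸ s) + s ≡ p
      p≡ = +-cancelʳ-≡ q _ _ (trans (cong (2 * (h ∸ q) + (q ∸ s) + s +_) (sym q≡))
        (trans (eq₁ (h ∸ q) (q ∸ s) s) (trans (cong (2 *_) h≡) (sym p+q))))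
      r≡ : 2 * (h ∸ q) + 2 * (q ∸ s) + s ≡ r
      r≡ = +-cancelʳ-≡ s _ _ (trans (eq₂ (h ∸ q) (q ∸ s) s) (trans (cong (2 *_) h≡) (sym r+s)))

    ordered-pairs : ∀ {p q r s} → Quadruple (p ∷ q ∷ r ∷ s ∷ []) → p + q ≡ 2 * h → r + s ≡ 2 * h →
      q < p → s < r → HasShape S
    ordered-pairs {p} {q} {r} {s} c p+q r+s q<p s<r with <-cmp p r
    ... | tri< p<r _ _ = ordered c p+q r+s q<p s<r p<r
    ... | tri> _ _ r<p = ordered (quadruple-↭ (Perm.++-comm (p ∷ q ∷ []) (r ∷ s ∷ [])) c) r+s p+q s<r q<p r<p
    ... | tri≈ _ p≡r _ with (_ , ((_ ∷ p≢r ∷ _) ∷ _) , _) ← c = contradiction p≡r p≢r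

    ordered-second : ∀ {p q r s} → Quadruple (p ∷ q ∷ r ∷ s ∷ []) → p + q ≡ 2 * h → r + s ≡ 2 * h →
      q < p → HasShape S
    ordered-second {p} {q} {r} {s} c p+q r+s q<p with <-cmp r s
    ... | tri> _ _ s<r = ordered-pairs c p+q r+s q<p s<r
    ... | tri< r<s _ _ = ordered-pairs (quadruple-↭ (prep p (prep q (swap r s ↭-refl))) c) p+q (trans (+-comm s r) r+s) q<p r<s
    ... | tri≈ _ r≡s _ with (_ , (_ ∷ _ ∷ (r≢s ∷ _) ∷ _) , _) ← c = contradiction r≡s r≢s

  pairs⇒shape : ∀ {p q r s} → Thresholds 7 S (p ∷ q ∷ r ∷ s ∷ []) → Unique (p ∷ q ∷ r ∷ s ∷ []) →
    All (0 <_) (p ∷ q ∷ r ∷ s ∷ []) → p + q ≡ 2 * h → r + s ≡ 2 * h → HasShape S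
  pairs⇒shape {p} {q} {r} {s} a u pos p+q r+s with <-cmp p q
  ... | tri> _ _ q<p = ordered-second (a , u , pos) p+q r+s q<p
  ... | tri< p<q _ _ = ordered-second (quadruple-↭ (swap p q ↭-refl) (a , u , pos)) (trans (+-comm q p) p+q) r+s p<q
  ... | tri≈ _ p≡q _ with (p≢q ∷ _) ∷ _ ← u = contradiction p≡q p≢q

-- As 2 is invertible modulo 7, the reflection of the residue classes has exactly one fixed class,
-- and its threshold is h with 2h = A. Class 0 has threshold 0, so its partner has threshold A. The
-- other four classes form two pairs with sum A.
selfConjugate-shape : ∀ {μ} → IsPartition μ → IsCore 7 μ → SelfConjugate μ → 0 < length μ → HasShape (beta μ)
selfConjugate-shape {μ} part core sc nonempty = by-residue (M % 7) refl (m%n<n M 7)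
  where
  S = beta μ
  dec = beta-decreasing (weaklyDecreasing part)
  closed = Cores.core-closed 7 part core
  M = at μ 0 + length μ ∸ 1
  M≡ : suc M ≡ at μ 0 + length μ
  M≡ = m+[n∸m]≡n {1} (≤-trans nonempty (m≤n+m (length μ) (at μ 0)))
  thr = threshold 7 S
  thr-0 : thr 0 ≡ 0
  thr-0 = Cores.threshold-zero 7 part core
  thr%7 : ∀ {r} → r < 7 → thr r % 7 ≡ r
  thr%7 = Abacus.threshold-residue 7 dec closed
  A = M + 7
  pair : ∀ i j → i < 7 → j < 7 → (i + j) % 7 ≡ M % 7 → thr i + thr j ≡ A
  pair i j p q e = Reflection.symmetric-thresholds 7 dec closed (selfConjugate⇒symmetric part sc M≡)
    (max-bound (weaklyDecreasing part) M≡) p q (trans e (sym ([m+n]%n≡m%n M 7)))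
  fixed : ∀ {r} → r < 7 → thr (thr r % 7) ≡ thr r
  fixed p = cong thr (thr%7 p)
  from-pairs : ∀ k i p q r s → M % 7 ≡ k → All (_< 7) (i ∷ p ∷ q ∷ r ∷ s ∷ []) → Unique (p ∷ q ∷ r ∷ s ∷ []) →
    All (0 <_) (p ∷ q ∷ r ∷ s ∷ []) → (i + i) % 7 ≡ k → (p + q) % 7 ≡ k → (r + s) % 7 ≡ k → HasShape S
  from-pairs k i p q r s refl (i< ∷ p< ∷ q< ∷ r< ∷ s< ∷ []) u (0<p ∷ 0<q ∷ 0<r ∷ 0<s ∷ []) ei ep er =
    pairs⇒shape {S} {thr i} thr-0 (fixed i<) thr-A
      (fixed p< ∷ fixed q< ∷ fixed r< ∷ fixed s< ∷ [])
      (unique-map⁺ thr (_% 7) (thr%7 p< ∷ thr%7 q< ∷ thr%7 r< ∷ thr%7 s< ∷ []) u)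
      (positive 0<p ∷ positive 0<q ∷ positive 0<r ∷ positive 0<s ∷ [])
      (trans (pair p q p< q< ep) (sym 2h)) (trans (pair r s r< s< er) (sym 2h))
    where
    2h : 2 * thr i ≡ A
    2h = trans (cong (thr i +_) (+-identityʳ (thr i))) (pair i i i< i< ei)
    thr-A : thr ((2 * thr i) % 7) ≡ 2 * thr i
    thr-A = trans (cong (λ x → thr (x % 7)) 2h) (trans (cong thr ([m+n]%n≡m%n M 7))
      (trans (trans (cong (_+ thr (M % 7)) (sym thr-0)) (pair 0 (M % 7) z<s (m%n<n M 7) (m%n%n≡m%n M 7))) (sym 2h)))
    positive : ∀ {r} → 0 < r → 0 < thr r
    positive {r} 0<r = <-≤-trans 0<r (m≤n+m r (count 7 r S * 7))
  <7 : ∀ {L} → True (All.all? (_<? 7) L) → All (_< 7) L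
  <7 = toWitness
  >0 : ∀ {L} → True (All.all? (0 <?_) L) → All (0 <_) L
  >0 = toWitness
  distinct : ∀ {L} → True (unique? L) → Unique L
  distinct = toWitness
  -- The symmetry about k = M mod 7 fixes 4k and pairs 2k with 6k and 3k with 5k.
  by-residue : ∀ k → M % 7 ≡ k → k < 7 → HasShape S
  -- M is a beta number, but class 0 contains none.
  by-residue 0 e _ = contradiction (Abacus.∈⇒<threshold 7 dec closed (max-∈-beta {μ} nonempty M≡))
    λ p → n≮0 (subst (M <_) (trans (cong thr e) thr-0) p)
  by-residue 1 e _ = from-pairs 1 4 2 6 3 5 e (<7 tt) (distinct tt) (>0 tt) refl refl refl
  by-residue 2 e _ = from-pairs 2 1 4 5 6 3 e (<7 tt) (distinct tt) (>0 tt) refl refl refl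
  by-residue 3 e _ = from-pairs 3 5 6 4 2 1 e (<7 tt) (distinct tt) (>0 tt) refl refl refl
  by-residue 4 e _ = from-pairs 4 2 1 3 5 6 e (<7 tt) (distinct tt) (>0 tt) refl refl refl
  by-residue 5 e _ = from-pairs 5 6 3 2 1 4 e (<7 tt) (distinct tt) (>0 tt) refl refl refl
  by-residue 6 e _ = from-pairs 6 3 5 1 4 2 e (<7 tt) (distinct tt) (>0 tt) refl refl refl
  by-residue (suc (suc (suc (suc (suc (suc (suc k))))))) _ p = contradiction p (m+n≮m 7 k)

-- The six candidates and the map φ

candidates : Bool → ℕ → ℕ → ℕ → List ℕ
candidates true  d g f = (2 * d + g + f) ∷ (2 * d + 2 * g + f) ∷ f ∷ (g + f) ∷ (d + g + f) ∷ 2 * (d + g + f) ∷ []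
candidates false d g f = (g + f) ∷ (2 * d + 2 * g + f) ∷ f ∷ (2 * d + g + f) ∷ (d + g + f) ∷ 2 * (d + g + f) ∷ []

candidates-↭ : ∀ β d g f → 0 ∷ candidates β d g f ↭ canonical d g f
candidates-↭ β d g f = ↭-trans (prep 0 (arrange β)) (Perm.↭-reverse (canonical d g f))
  where
  A = 2 * (d + g + f)
  R = 2 * d + 2 * g + f
  P = 2 * d + g + f
  h = d + g + f
  Q = g + f
  arrange : ∀ β → candidates β d g f ↭ f ∷ Q ∷ h ∷ P ∷ R ∷ A ∷ []
  arrange true  = Perm.++⁺ʳ (A ∷ []) (Perm.++-comm (P ∷ R ∷ []) (f ∷ Q ∷ h ∷ []))
  arrange false = ↭-sym (↭-trans (swap f Q ↭-refl) (prep Q (↭-trans (Perm.shift R (f ∷ h ∷ P ∷ []) (A ∷ []))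
    (prep R (prep f (swap h P ↭-refl))))))

triple-total : ∀ β d g f → (smallest β d g + f) + (2 * d + 2 * g + f) ≡ smallest β d g + 2 * (d + g + f)
triple-total true  = eq
  where
  eq : ∀ d g f → 2 * d + g + f + (2 * d + 2 * g + f) ≡ 2 * d + g + 2 * (d + g + f)
  eq = solve-∀
triple-total false = eq
  where
  eq : ∀ d g f → g + f + (2 * d + 2 * g + f) ≡ g + 2 * (d + g + f)
  eq = solve-∀

triple-total-∸ : ∀ β d g f → (smallest β d g + f) + (2 * d + 2 * g + f) ∸ smallest β d g ≡ 2 * (d + g + f)
triple-total-∸ β d g f = trans (cong (_∸ smallest β d g) (triple-total β d g f)) (m+n∸m≡n (smallest β d g) _)

sumB-triple : ∀ λ′ β d g f → sortedB λ′ ≡ tripleTuple β d g f → sumB λ′ ≡ 2 * (d + g + f)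
sumB-triple λ′ β d g f s with sortedB λ′ | s
... | _ | refl = triple-total-∸ β d g f

-- The sign β only exchanges h + d and h - d between the places of the middle b and of the
-- difference of the largest and smallest b. The other four entries h + e, h - e, h, 2h are
-- unaffected, so φ cannot see the sign.
calC-triple : ∀ λ′ β d g f → sortedB λ′ ≡ tripleTuple β d g f → calC λ′ ≡ candidates β d g f
calC-triple λ′ β d g f s with sortedB λ′ | s
... | _ | refl = trans (cong₂ (λ c l → smallest β d g + f ∷ 2 * d + 2 * g + f ∷ c ∷ l)
    (m+n∸m≡n (smallest β d g) f)
    (cong (2 * d + 2 * g + f ∸ smallest β d g ∷_) (cong₂ (λ x y → x ∷ y ∷ [])
      (trans (cong (_/ 2) (trans (triple-total-∸ β d g f) (*-comm 2 (d + g + f)))) (m*n/n≡m (d + g + f) 2))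
      (triple-total-∸ β d g f))))
  (rest β)
  where
  eq₁ : ∀ d g f → 2 * d + 2 * g + f ≡ 2 * d + g + (g + f)
  eq₁ = solve-∀
  eq₂ : ∀ d g f → 2 * d + 2 * g + f ≡ g + (2 * d + g + f)
  eq₂ = solve-∀
  rest : ∀ β → smallest β d g + f ∷ 2 * d + 2 * g + f ∷ f ∷ (2 * d + 2 * g + f ∸ smallest β d g) ∷ d + g + f ∷ 2 * (d + g + f) ∷ []
    ≡ candidates β d g f
  rest true  = cong (λ c → 2 * d + g + f ∷ 2 * d + 2 * g + f ∷ f ∷ c ∷ d + g + f ∷ 2 * (d + g + f) ∷ [])
    (trans (cong (_∸ (2 * d + g)) (eq₁ d g f)) (m+n∸m≡n (2 * d + g) (g + f)))
  rest false = cong (λ c → g + f ∷ 2 * d + 2 * g + f ∷ f ∷ c ∷ d + g + f ∷ 2 * (d + g + f) ∷ [])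
    (trans (cong (_∸ g) (eq₂ d g f)) (m+n∸m≡n g (2 * d + g + f)))

-- The occurrence of the residue i excludes the fallback value 0 of `pick`.
pick-∈ : ∀ i {L} → i ∈ map (_% 7) L → pick i L ∈ L × pick i L % 7 ≡ i
pick-∈ i {x ∷ xs} p with x % 7 ≡ᵇ i in e | p
... | true  | _ = here refl , ≡ᵇ⇒≡ (x % 7) i (subst T (sym e) tt)
... | false | here i≡ = contradiction (≡⇒≡ᵇ (x % 7) i (sym i≡)) (subst T e)
... | false | there q = let r , s = pick-∈ i q in there r , s

module _ {β : Bool} {d g f : ℕ} (complete : CompleteResidues 7 (canonical d g f)) where

  candidates-complete : CompleteResidues 7 (0 ∷ candidates β d g f)
  candidates-complete = ↭-trans (Perm.map⁺ (_% 7) (candidates-↭ β d g f)) complete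

  candidates-residues : All (0 ≢_) (map (_% 7) (candidates β d g f)) × Unique (map (_% 7) (candidates β d g f))
  candidates-residues with u ∷ us ← Abacus.complete-unique 7 {D = 0 ∷ candidates β d g f} candidates-complete = u , us

  residue-∈ : ∀ {i} → 0 < i → i < 7 → i ∈ map (_% 7) (candidates β d g f)
  residue-∈ {i} 0<i i<7 with Abacus.complete-∈ 7 {D = 0 ∷ candidates β d g f} candidates-complete i<7
  ... | _ , here refl , i≡0 = contradiction i≡0 (≢-sym (<⇒≢ 0<i))
  ... | x , there p   , i≡x = subst (_∈ map (_% 7) (candidates β d g f)) (sym i≡x) (∈-map⁺ (_% 7) p)

  pick-threshold : ∀ {S} → Thresholds 7 S (canonical d g f) → ∀ {i} → 0 < i → i < 7 →
    pick i (candidates β d g f) / 7 ≡ count 7 i S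
  pick-threshold {S} thr {i} 0<i i<7 =
    let p∈ , p%7 = pick-∈ i (residue-∈ 0<i i<7)
    in trans (cong (_/ 7) (trans (sym (All.lookup thr (∈-resp-↭ (candidates-↭ β d g f) (there p∈)))) (cong (threshold 7 S) p%7)))
         (Cores.threshold-/ 7 S i<7)

  -- A candidate is recovered from its residue and its floor, and if the floor is the count of its
  -- class, this recovery is the definition of the threshold.
  pick⇒thresholds : ∀ {S} → threshold 7 S 0 ≡ 0 →
    (∀ {i} → 0 < i → i < 7 → pick i (candidates β d g f) / 7 ≡ count 7 i S) → Thresholds 7 S (canonical d g f)
  pick⇒thresholds {S} thr-0 picks = All-resp-↭ (candidates-↭ β d g f) (thr-0 ∷ All.tabulate thr)
    where
    thr : ∀ {x} → x ∈ candidates β d g f → threshold 7 S (x % 7) ≡ x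
    thr {x} x∈ = trans (cong (λ c → c * 7 + i) (sym (picks 0<i i<7))) (trans (+-comm _ i)
      (trans (cong (_+ pick i (candidates β d g f) / 7 * 7) (sym p%7))
      (trans (sym (m≡m%n+[m/n]*n (pick i (candidates β d g f)) 7))
        (unique-injective (proj₂ candidates-residues) p∈ x∈ p%7))))
      where
      i = x % 7
      i<7 = m%n<n x 7
      0<i : 0 < i
      0<i = n≢0⇒n>0 λ e → All.lookup (proj₁ candidates-residues) (∈-map⁺ (_% 7) x∈) (sym e)
      p∈ = proj₁ (pick-∈ i (residue-∈ 0<i i<7))
      p%7 = proj₂ (pick-∈ i (residue-∈ 0<i i<7))

φ-from-counts : ∀ {λ′ μ L} → calC λ′ ≡ L → count 7 0 (beta μ) ≡ 0 →
  (∀ {i} → 0 < i → i < 7 → pick i L / 7 ≡ count 7 i (beta μ)) → φ λ′ ≡ abacus 7 μ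
φ-from-counts {λ′} {μ} refl zero≡ e = trans
  (cong₂ V._∷_ (sym zero≡) (cong₂ V._∷_ (at-runner 1) (cong₂ V._∷_ (at-runner 2) (cong₂ V._∷_ (at-runner 3)
    (cong₂ V._∷_ (at-runner 4) (cong₂ V._∷_ (at-runner 5) (cong₂ V._∷_ (at-runner 6) refl)))))))
  (sym (Cores.abacus-count 7 μ))
  where
  at-runner : ∀ i {p : True (0 <? i)} {q : True (i <? 7)} → pick i (calC λ′) / 7 ≡ count 7 i (beta μ)
  at-runner i {p} {q} = e (toWitness p) (toWitness q)

counts-from-φ : ∀ {λ′ μ L} → calC λ′ ≡ L → φ λ′ ≡ abacus 7 μ →
  ∀ {i} → 0 < i → i < 7 → pick i L / 7 ≡ count 7 i (beta μ)
counts-from-φ {λ′} {μ} refl e = at-runner _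
  where
  lookup≡ : ∀ c → V.lookup (φ λ′) c ≡ V.lookup (V.tabulate (λ c → count 7 (toℕ c) (beta μ))) c
  lookup≡ c = cong (λ v → V.lookup v c) (trans e (Cores.abacus-count 7 μ))
  at-runner : ∀ i → 0 < i → i < 7 → pick i (calC λ′) / 7 ≡ count 7 i (beta μ)
  at-runner 1 _ _ = lookup≡ (Fin.suc Fin.zero)
  at-runner 2 _ _ = lookup≡ (Fin.suc (Fin.suc Fin.zero))
  at-runner 3 _ _ = lookup≡ (Fin.suc (Fin.suc (Fin.suc Fin.zero)))
  at-runner 4 _ _ = lookup≡ (Fin.suc (Fin.suc (Fin.suc (Fin.suc Fin.zero))))
  at-runner 5 _ _ = lookup≡ (Fin.suc (Fin.suc (Fin.suc (Fin.suc (Fin.suc Fin.zero)))))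
  at-runner 6 _ _ = lookup≡ (Fin.suc (Fin.suc (Fin.suc (Fin.suc (Fin.suc (Fin.suc Fin.zero))))))
  at-runner (suc (suc (suc (suc (suc (suc (suc k))))))) _ p = contradiction p (m+n≮m 7 k)

count-zero : ∀ {μ} → IsPartition μ → IsCore 7 μ → count 7 0 (beta μ) ≡ 0
count-zero {μ} part core = m*n≡0⇒m≡0 _ 7 (trans (sym (+-identityʳ _)) (Cores.threshold-zero 7 part core))

4-core-norm : ∀ {n λ′} β d g f → InC 4 (7 * n + 2) λ′ → CompleteResidues 4 (0 ∷ triple β d g f) →
  Thresholds 4 (beta λ′) (0 ∷ triple β d g f) → norm d g f ≡ 56 * n + 21
4-core-norm {n} β d g f (part , core , size≡) complete thr =
  trans (sym (core-size-4 β d g f part (Cores.core-closed 4 part core) complete thr))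
    (trans (cong (λ m → 8 * m + 5) size≡) (eq n))
  where
  eq : ∀ n → 8 * (7 * n + 2) + 5 ≡ 56 * n + 21
  eq = solve-∀

-- The image of φ and its fibres

module _ (n : ℕ) (n≢4 : n % 7 ≢ 4) where

  φ-well-defined : (λ′ : Partition) → InC 4 (7 * n + 2) λ′ →
    2 ∣ sumB λ′ × All (λ c → c % 7 ≢ 0) (calC λ′) × Unique (map (λ c → c % 7) (calC λ′))
    × ∃ (λ μ → InSC 7 (8 * n + 1) μ × abacus 7 μ ≡ φ λ′)
  φ-well-defined λ′ inC@(part , core , _) = from-triple (4-core-triple part core)
    where
    from-triple : TripleOf λ′ → 2 ∣ sumB λ′ × All (λ c → c % 7 ≢ 0) (calC λ′) × Unique (map (λ c → c % 7) (calC λ′))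
      × ∃ (λ μ → InSC 7 (8 * n + 1) μ × abacus 7 μ ≡ φ λ′)
    from-triple (triple-of {β} {d} {g} {f} _ 0<f s complete₄ thr₄) =
        subst (2 ∣_) (sym (sumB-triple λ′ β d g f s)) (m∣m*n (d + g + f))
      , subst (All (λ c → c % 7 ≢ 0)) (sym c≡) (All.map ≢-sym (All.map⁻ (proj₁ residues)))
      , subst (λ L → Unique (map (_% 7) L)) (sym c≡) (proj₂ residues)
      , image (7-core-with-thresholds {n} {d} {g} {f} 0<f N complete)
      where
      N = 4-core-norm {n} {λ′} β d g f inC complete₄ thr₄
      complete = canonical-complete {n} d g f n≢4 N
      c≡ = calC-triple λ′ β d g f s
      residues = candidates-residues {β} {d} {g} {f} complete
      image : (∃ λ μ → InSC 7 (8 * n + 1) μ × Thresholds 7 (beta μ) (canonical d g f)) →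
        ∃ (λ μ → InSC 7 (8 * n + 1) μ × abacus 7 μ ≡ φ λ′)
      image (μ , inSC@((part′ , core′ , _) , _) , thr) = μ , inSC
        , sym (φ-from-counts {λ′} {μ} c≡ (count-zero part′ core′) (pick-threshold {β} {d} {g} {f} complete {beta μ} thr))

  module Preimages {μ : Partition} {d g f : ℕ} (part : IsPartition μ) (core : IsCore 7 μ) (size≡ : size μ ≡ 8 * n + 1)
    (0<d : 0 < d) (0<g : 0 < g) (0<f : 0 < f) (thr : Thresholds 7 (beta μ) (canonical d g f)) where

    complete : CompleteResidues 7 (canonical d g f)
    -- In this direction no norm is available yet. The residues differ because the entries do and
    -- each entry is the threshold of its residue.
    complete = Abacus.unique⇒complete 7 {D = canonical d g f}
      (unique-map⁺ (_% 7) (threshold 7 (beta μ)) thr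
        (AllPairs.map (λ y<x → ≢-sym (<⇒≢ y<x)) (canonical-decreasing 0<d 0<g 0<f))) refl

    norm≡ : norm d g f ≡ 56 * n + 21
    norm≡ = trans (sym (core-size-7 d g f part (Cores.core-closed 7 part core) complete thr))
      (trans (cong (λ m → 7 * m + 14) size≡) (eq n))
      where
      eq : ∀ n → 7 * (8 * n + 1) + 14 ≡ 56 * n + 21
      eq = solve-∀

    φ≡abacus : ∀ β {λ′} → sortedB λ′ ≡ tripleTuple β d g f → φ λ′ ≡ abacus 7 μ
    φ≡abacus β {λ′} s = φ-from-counts {λ′} {μ} (calC-triple λ′ β d g f s) (count-zero part core)
      (pick-threshold {β} {d} {g} {f} complete {beta μ} thr)

    -- The canonical list of λ′ and that of μ both enumerate the thresholds of μ in decreasing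
    -- order, so they coincide. This fixes d, g, f and leaves only the sign β free.
    preimage-thresholds : ∀ {λ′} → InC 4 (7 * n + 2) λ′ → φ λ′ ≡ abacus 7 μ →
      ∃ λ β → Thresholds 4 (beta λ′) (0 ∷ triple β d g f)
    preimage-thresholds {λ′} inC@(part′ , core′ , _) e = from-triple (4-core-triple part′ core′)
      where
      from-triple : TripleOf λ′ → ∃ λ β → Thresholds 4 (beta λ′) (0 ∷ triple β d g f)
      from-triple (triple-of {β} {d′} {g′} {f′} 0<g′ 0<f′ s complete₄ thr₄) =
        β , transport (canonical-injective {d′} {g′} {f′} {d} {g} {f} (decreasing-≡
          (canonical-decreasing (canonical-positive d′ g′ f′ complete′) 0<g′ 0<f′)
          (canonical-decreasing 0<d 0<g 0<f)
          (Abacus.thresholds-⊆ 7 {S = beta μ} {D = canonical d′ g′ f′} {D′ = canonical d g f} thr′ thr complete)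
          (Abacus.thresholds-⊆ 7 {S = beta μ} {D = canonical d g f} {D′ = canonical d′ g′ f′} thr thr′ complete′)))
        where
        complete′ : CompleteResidues 7 (canonical d′ g′ f′)
        complete′ = canonical-complete {n} d′ g′ f′ n≢4 (4-core-norm {n} {λ′} β d′ g′ f′ inC complete₄ thr₄)
        thr′ : Thresholds 7 (beta μ) (canonical d′ g′ f′)
        thr′ = pick⇒thresholds {β} {d′} {g′} {f′} complete′ {beta μ} (Cores.threshold-zero 7 part core)
          (counts-from-φ {λ′} {μ} (calC-triple λ′ β d′ g′ f′ s) e)
        transport : d′ ≡ d × g′ ≡ g × f′ ≡ f → Thresholds 4 (beta λ′) (0 ∷ triple β d g f)
        transport (refl , refl , refl) = thr₄

    two-preimages : CoreWithTriple n true d g f → CoreWithTriple n false d g f →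
      ∃₂ (λ λ₁ λ₂ → λ₁ ≢ λ₂
        × InC 4 (7 * n + 2) λ₁ × φ λ₁ ≡ abacus 7 μ
        × InC 4 (7 * n + 2) λ₂ × φ λ₂ ≡ abacus 7 μ
        × ((λ′ : Partition) → InC 4 (7 * n + 2) λ′ → φ λ′ ≡ abacus 7 μ → λ′ ≡ λ₁ ⊎ λ′ ≡ λ₂))
    two-preimages (core-with-triple {λ₁} in₁@(p₁ , c₁ , _) s₁ thr₁) (core-with-triple {λ₂} in₂@(p₂ , c₂ , _) s₂ thr₂) =
      λ₁ , λ₂ , distinct , in₁ , φ≡abacus true {λ₁} s₁ , in₂ , φ≡abacus false {λ₂} s₂
         , λ λ′ in′ e → one-of in′ (preimage-thresholds {λ′} in′ e)
      where
      distinct : λ₁ ≢ λ₂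
      -- The smallest entries of the two sorted triples differ by 2d.
      distinct e = <⇒≢ (<-≤-trans 0<d (m≤m+n d (d + 0)))
        (sym (+-cancelʳ-≡ g (2 * d) 0 (cong proj₁ (trans (sym s₁) (trans (cong sortedB e) s₂)))))
      one-of : ∀ {λ′} → InC 4 (7 * n + 2) λ′ → (∃ λ β → Thresholds 4 (beta λ′) (0 ∷ triple β d g f)) → λ′ ≡ λ₁ ⊎ λ′ ≡ λ₂
      one-of {λ′} (p , c , _) (true , t) = inj₁
        (Cores.core-unique 4 {λ′} {λ₁} {0 ∷ triple true d g f} p c p₁ c₁ (triple-complete {n} true d g f norm≡) t thr₁)
      one-of {λ′} (p , c , _) (false , t) = inj₂
        (Cores.core-unique 4 {λ′} {λ₂} {0 ∷ triple false d g f} p c p₂ c₂ (triple-complete {n} false d g f norm≡) t thr₂)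

  φ-two-to-one : (μ : Partition) → InSC 7 (8 * n + 1) μ →
    ∃₂ (λ λ₁ λ₂ → λ₁ ≢ λ₂
      × InC 4 (7 * n + 2) λ₁ × φ λ₁ ≡ abacus 7 μ
      × InC 4 (7 * n + 2) λ₂ × φ λ₂ ≡ abacus 7 μ
      × ((λ′ : Partition) → InC 4 (7 * n + 2) λ′ → φ λ′ ≡ abacus 7 μ → λ′ ≡ λ₁ ⊎ λ′ ≡ λ₂))
  φ-two-to-one μ ((part , core , size≡) , sc) = from-shape (selfConjugate-shape part core sc (nonempty {μ} size≡))
    where
    nonempty : ∀ {μ} → size μ ≡ 8 * n + 1 → 0 < length μ
    nonempty {[]}    e = contradiction (trans e (+-comm (8 * n) 1)) λ ()
    nonempty {_ ∷ _} _ = z<s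
    from-shape : HasShape (beta μ) →
      ∃₂ (λ λ₁ λ₂ → λ₁ ≢ λ₂
        × InC 4 (7 * n + 2) λ₁ × φ λ₁ ≡ abacus 7 μ
        × InC 4 (7 * n + 2) λ₂ × φ λ₂ ≡ abacus 7 μ
        × ((λ′ : Partition) → InC 4 (7 * n + 2) λ′ → φ λ′ ≡ abacus 7 μ → λ′ ≡ λ₁ ⊎ λ′ ≡ λ₂))
    from-shape (d , g , f , 0<d , 0<g , 0<f , thr) =
      two-preimages (4-core-with-triple true d 0<g 0<f norm≡) (4-core-with-triple false d 0<g 0<f norm≡)
      where open Preimages part core size≡ 0<d 0<g 0<f thr

theorem5p1 : (n : ℕ) → n % 7 ≢ 4 →
    ((λ′ : Partition) → InC 4 (7 * n + 2) λ′ →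
    (2 ∣ sumB λ′)
    × All (λ c → c % 7 ≢ 0) (calC λ′)
    × Unique (map (λ c → c % 7) (calC λ′))
    × ∃ (λ μ → InSC 7 (8 * n + 1) μ × abacus 7 μ ≡ φ λ′))
    × ((μ : Partition) → InSC 7 (8 * n + 1) μ →
    ∃₂ (λ λ₁ λ₂ → λ₁ ≢ λ₂
    × InC 4 (7 * n + 2) λ₁ × φ λ₁ ≡ abacus 7 μ
    × InC 4 (7 * n + 2) λ₂ × φ λ₂ ≡ abacus 7 μ
    × ((λ′ : Partition) → InC 4 (7 * n + 2) λ′ → φ λ′ ≡ abacus 7 μ → λ′ ≡ λ₁ ⊎ λ′ ≡ λ₂)))
theorem5p1 n n≢4 = φ-well-defined n n≢4 , φ-two-to-one n n≢4
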